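{- Let $p$ be a prime, $q=p^e$, $m,k\ge1$, and let $f\in\mathbb{F}_{q^m}[x_1,\dots,x_k]$ be a polynomial of degree $d\ge1$. Then \[\nu_p\big(N(f=y^q-y)\big)\ge e\Big\lceil\frac{mk}{W_q(d,\mathbb{F}_{q^m}^k)}\Big\rceil,\] where $W_q(d,\mathbb{F}_{q^m}^k)=\max\{S_q(\boldsymbol{t}):\boldsymbol{t}\in[0,q^m-1]^k,\ |\boldsymbol{t}|\le d\}$.
   Context: $N(f=y^q-y)$ denotes the number of $(x_1,\dots,x_k,y)\in\mathbb{F}_{q^m}^{k+1}$ with $f(x_1,\dots,x_k)=y^q-y$; $\nu_p$ is the $p$-adic valuation. For $\boldsymbol{t}=(t_1,\dots,t_k)$, $|\boldsymbol{t}|=\sum t_i$ and $S_q(\boldsymbol{t})=\sum_i S_q(t_i)$, where $S_q(a)$ is the sum of the base-$q$ digits of $a$. -}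

module Defs where

open import Algebra.Bundles using (CommutativeRing)
import Algebra.Definitions
import Algebra.Properties.Semiring.Exp
open import Data.Digit using (Expansion; toDigits; fromDigits)
open import Data.Fin.Base as Fin using (Fin)
import Data.Fin.Properties as Fin
open import Data.List.Base as List using (List; []; _∷_)
open import Data.List.Extrema.Nat using (max; v<max⁺)
open import Data.List.Membership.Propositional using (_∈_; _∉_; lose)
open import Data.List.Membership.Propositional.Properties
  using (∈-cartesianProductWith⁺; ∈-upTo⁺; ∈-filter⁺; ∈-map⁺)
open import Data.List.Relation.Unary.Any using (here)
open import Data.List.Relation.Unary.Unique.Propositional using (Unique)
open import Data.Nat.Base
  using (ℕ; zero; suc; pred; _+_; _*_; _/_; _^_; _≤_; _<_; _>_; NonZero; NonTrivial;
         nonTrivial⇒n>1; nonTrivial⇒nonZero; >-nonZero; >-nonZero⁻¹)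
open import Data.Nat.Divisibility using (_∣?_)
open import Data.Nat.ListAction using (sum)
open import Data.Nat.Properties
open import Data.Product.Base using (∃-syntax; _×_; _,_; proj₁; proj₂)
open import Data.Sum.Base using (inj₂)
open import Data.Vec.Base as Vec using (Vec; []; _∷_)
open import Function.Bundles using (Inverse)
open import Function.Properties.Inverse using (Inverse⇒Injection)
open import Level using (Level; _⊔_) renaming (suc to lsuc)
open import Relation.Binary.Definitions using (Decidable)
open import Relation.Binary.PropositionalEquality
  using (_≡_; refl; sym; trans; cong; cong₂; subst; setoid)
open import Relation.Nullary.Construct.Add.Supremum using (_⁺; ⊤⁺; [_])
open import Relation.Nullary.Decidable using (fromWitness; via-injection)
open import Relation.Nullary.Negation using (¬_)

tuples : ∀ {a} {A : Set a} → List A → (k : ℕ) → List (Vec A k)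
tuples xs zero    = List.[ [] ]
tuples xs (suc k) = List.cartesianProductWith _∷_ xs (tuples xs k)

⌈_/_⌉ : (a b : ℕ) .{{_ : NonZero b}} → ℕ
⌈ a / b ⌉ = (a + pred b) / b

-- The p-adic valuation, with ν p 0 = ∞.  Searching the exponents r < n is
-- enough: for p ≥ 2 and n ≥ 1, p ^ r ∣ n forces r < p ^ r ≤ n.
ν : ℕ → ℕ → ℕ ⁺
ν p zero      = ⊤⁺
ν p n@(suc _) = [ max 0 (List.filter (λ r → p ^ r ∣? n) (List.upTo n)) ]

digits : (q : ℕ) .{{_ : NonTrivial q}} → ℕ → Expansion q
digits q a = proj₁ (toDigits q {fromWitness (nonTrivial⇒n>1 q)} a)

digitSum : (q : ℕ) .{{_ : NonTrivial q}} → ℕ → ℕ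
digitSum q a = sum (List.map Fin.toℕ (digits q a))

S : (q : ℕ) .{{_ : NonTrivial q}} → ∀ {k} → Vec ℕ k → ℕ
S q t = Vec.sum (Vec.map (digitSum q) t)

-- W_q(d, 𝔽^k) for a field 𝔽 with q ^ m elements.  The default value 0 of max
-- is harmless: the maximum is over a list containing S q 0.
W : (q : ℕ) .{{_ : NonTrivial q}} → (m k d : ℕ) → ℕ
W q m k d =
  max 0 (List.map (S q) (List.filter (λ t → Vec.sum t ≤? d) (tuples (List.upTo (q ^ m)) k)))

private
  digitSum-zero : ∀ {q} (ds : Expansion q) →
                  sum (List.map Fin.toℕ ds) ≡ 0 → fromDigits ds ≡ 0
  digitSum-zero     []       _  = refl
  digitSum-zero {q} (d ∷ ds) eq =
    cong₂ _+_ (m+n≡0⇒m≡0 (Fin.toℕ d) eq)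
              (cong (_* q) (digitSum-zero ds (m+n≡0⇒n≡0 (Fin.toℕ d) eq)))

  digitSum-one : ∀ q .{{_ : NonTrivial q}} → digitSum q 1 > 0
  digitSum-one q = n≢0⇒n>0 λ eq →
    0≢1+n (trans (sym (digitSum-zero (digits q 1) eq))
                 (proj₂ (toDigits q {fromWitness (nonTrivial⇒n>1 q)} 1)))

  ∈-replicate : ∀ {a} {A : Set a} {x : A} {xs} → x ∈ xs → ∀ k → Vec.replicate k x ∈ tuples xs k
  ∈-replicate x∈ zero    = here refl
  ∈-replicate x∈ (suc k) = ∈-cartesianProductWith⁺ _∷_ x∈ (∈-replicate x∈ k)

  sum-zeros : ∀ k → Vec.sum (Vec.replicate k 0) ≡ 0
  sum-zeros zero    = refl
  sum-zeros (suc k) = sum-zeros k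

private
  W-positive : ∀ q m k d .{{_ : NonTrivial q}} .{{_ : NonZero m}} .{{_ : NonZero k}}
               .{{_ : NonZero d}} → W q m k d > 0
  W-positive q (suc m) (suc k) (suc d) =
    v<max⁺ 0 _ (inj₂ (lose (∈-map⁺ (S q) (∈-filter⁺ (λ t → Vec.sum t ≤? suc d) e∈ e≤d)) Se>0))
    where
    e : Vec ℕ (suc k)
    e = 1 ∷ Vec.replicate k 0

    1<q^m : 1 < q ^ suc m
    1<q^m = ≤-trans (nonTrivial⇒n>1 q)
                    (m≤m*n q (q ^ m) {{m^n≢0 q m {{nonTrivial⇒nonZero q}}}})

    e∈ : e ∈ tuples (List.upTo (q ^ suc m)) (suc k)
    e∈ = ∈-cartesianProductWith⁺ _∷_ (∈-upTo⁺ 1<q^m) (∈-replicate (∈-upTo⁺ (<⇒≤ 1<q^m)) k)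

    e≤d : Vec.sum e ≤ suc d
    e≤d = +-mono-≤ (≤-refl {1}) (≤-trans (≤-reflexive (sum-zeros k)) _≤_.z≤n)

    Se>0 : 0 < S q e
    Se>0 = ≤-trans (digitSum-one q) (m≤m+n _ _)

W-nonZero : ∀ q m k d .{{_ : NonTrivial q}} .{{_ : NonZero m}} .{{_ : NonZero k}}
            .{{_ : NonZero d}} → NonZero (W q m k d)
W-nonZero q m k d = >-nonZero (W-positive q m k d)

record FiniteField (c ℓ : Level) (n : ℕ) : Set (lsuc (c ⊔ ℓ)) where
  field
    commutativeRing : CommutativeRing c ℓ

  open CommutativeRing commutativeRing public
    using (Carrier; _≈_; 0#; 1#)
    renaming (_+_ to _+ᶠ_; _*_ to _*ᶠ_; _-_ to _-ᶠ_)
  open Algebra.Definitions _≈_ using (Invertible)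
  open Algebra.Properties.Semiring.Exp (CommutativeRing.semiring commutativeRing) public
    using () renaming (_^_ to _^ᶠ_)

  field
    0≉1         : ¬ 0# ≈ 1#
    invertible  : ∀ x → ¬ x ≈ 0# → Invertible 1# _*ᶠ_ x
    enumeration : Inverse (CommutativeRing.setoid commutativeRing) (setoid (Fin n))

  _≈?_ : Decidable _≈_
  _≈?_ = via-injection (Inverse⇒Injection enumeration) Fin._≟_

  -- One representative of each ≈-class.
  elements : List Carrier
  elements = List.map (Inverse.from enumeration) (List.allFin n)

module _ {c ℓ n} (F : FiniteField c ℓ n) where
  open FiniteField F

  -- A polynomial in k variables is a finitely supported family of coefficients
  -- indexed by exponent vectors; coefficients on the support list may vanish.
  record Polynomial (k : ℕ) : Set (c ⊔ ℓ) where
    field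
      coeff         : Vec ℕ k → Carrier
      support       : List (Vec ℕ k)
      unique        : Unique support
      coeff-outside : ∀ t → t ∉ support → coeff t ≈ 0#

module _ {c ℓ n} {F : FiniteField c ℓ n} where
  open FiniteField F
  open Polynomial

  HasDegree : ∀ {k} → Polynomial F k → ℕ → Set ℓ
  HasDegree f d = (∃[ t ] Vec.sum t ≡ d × ¬ coeff f t ≈ 0#)
                × (∀ t → d < Vec.sum t → coeff f t ≈ 0#)

  monomial : ∀ {k} → Vec ℕ k → Vec Carrier k → Carrier
  monomial t x = Vec.foldr′ _*ᶠ_ 1# (Vec.zipWith _^ᶠ_ x t)

  eval : ∀ {k} → Polynomial F k → Vec Carrier k → Carrier
  eval f x = List.foldr _+ᶠ_ 0# (List.map (λ t → coeff f t *ᶠ monomial t x) (support f))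

  -- N(f = y^q - y)
  N : ∀ {k} → Polynomial F k → (q : ℕ) → ℕ
  N {k} f q = List.length
    (List.filter (λ (x , y) → eval f x ≈? ((y ^ᶠ q) -ᶠ y))
                 (List.cartesianProduct (tuples elements k) elements))

-- Let Q = q ^ m.  In the monoid ring ℤ[F] of the multiplicative monoid of F let
-- I be the kernel of ℤ[F] → F.  If X ∈ ℤ[F] lifts s ∈ F then X ^ ((Q - 1) p ^ K)
-- is congruent modulo I ^ K to 0 or 1, according to whether s = 0.  Summing over
-- all points, with X the termwise lift of f(x) - y ^ q + y, gives -N up to the
-- total number of points.
--
-- On the other hand X ^ ((Q - 1) p ^ K) is a combination of products of p-power
-- powers of the terms of X, in which a factor p accompanies every p - 1 factors
-- beyond the first e m (p - 1).  The sum of such a product over all points is a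
-- product of power sums Σ [a] ^ u over a ∈ F, each of which lies in every power of I
-- unless Q - 1 ∣ u, and in I ^ (e m) if u = 0.  Comparing base q digit sums of
-- the exponents, as in the proof of Ax's theorem, puts everything in I ^ K for
-- K = e ⌈ m k / W ⌉.
--
-- Finally N · 1 ∈ I ^ K forces p ^ K ∣ N: if φ denotes the ring endomorphism [a] ↦ [a ^ p],
-- the operation δ x = (φ x - x ^ p) / p maps I ^ (n + 1) into I ^ n and lowers
-- the p-adic valuation of an integer by exactly one.
module Submission where

open import Defs
open import Algebra.Bundles using (CommutativeMonoid; CommutativeRing)
open import Algebra.Morphism.Structures using (IsRingHomomorphism)
import Algebra.Properties.CommutativeMonoid.Sum
import Algebra.Properties.CommutativeSemiring.Binomial
import Algebra.Properties.CommutativeSemiring.Exp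
import Algebra.Properties.Group
import Algebra.Properties.Ring
import Algebra.Properties.Semiring.Mult
import Algebra.Properties.Semiring.Sum
import Algebra.Solver.Ring.NaturalCoefficients.Default
open import Data.Bool.Base using (if_then_else_)
open import Data.Digit using (Expansion; toDigits; fromDigits)
open import Data.Fin.Base as Fin using (Fin; zero; suc; toℕ)
open import Data.Fin.Permutation using (permutation)
import Data.Fin.Properties as Fin
open import Data.Integer.Base as ℤ using (ℤ; 0ℤ; 1ℤ)
import Data.Integer.Properties as ℤ
import Data.Integer.Solver
open import Data.List.Base as List using (List; []; _∷_; _++_; length)
open import Data.List.Extrema.Nat using (xs≤max; v≤max⁺)
open import Data.List.Membership.Propositional using (_∈_; lose)
open import Data.List.Membership.Propositional.Properties
  using (∈-cartesianProductWith⁺; ∈-upTo⁺; ∈-filter⁺; ∈-map⁺)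
import Data.List.Properties as List
open import Data.List.Relation.Unary.All as All using (All; []; _∷_)
open import Data.List.Relation.Unary.Any using (here)
open import Data.Nat.Base as ℕ
  using (ℕ; zero; suc; pred; NonZero; NonTrivial; _≤_; _<_; _∸_; z≤n; s≤s;
         nonTrivial⇒nonZero; nonTrivial⇒n>1)
open import Data.Nat.Combinatorics using (_C_; nCn≡1; nC1≡n; nCk+nC[k+1]≡[n+1]C[k+1])
open import Data.Nat.Coprimality using (coprime-Bézout)
open import Data.Nat.Divisibility hiding (quotient)
open import Data.Nat.DivMod using (_%_; m≡m%n+[m/n]*n; m%n<n; m%n≤m; m<n⇒m%n≡m; [m+n]%n≡m%n; m<n*o⇒m/o<n; m*[n/m]≡n)
open import Data.Nat.GCD using (module Bézout)
import Data.Nat.ListAction as ℕ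
open import Data.Nat.ListAction.Properties using (sum-++)
open import Data.Nat.Primality using (Prime; prime⇒nonZero; prime⇒nonTrivial; prime⇒irreducible; euclidsLemma)
import Data.Nat.Properties as ℕ
open import Data.Nat.Solver using (module +-*-Solver)
open import Data.Product.Base using (∃-syntax; _,_; proj₁; proj₂) renaming (_×_ to _∧_)
open import Data.Sum.Base using (_⊎_; inj₁; inj₂)
open import Data.Vec.Base as Vec using (Vec; []; _∷_; lookup)
open import Function.Base using (_∘_)
open import Function.Bundles using (Inverse)
open import Level using (_⊔_)
open import Relation.Binary.Construct.Add.Supremum.NonStrict _≤_ using (_≤⁺_; [_]; _≤⊤⁺)
open import Relation.Binary.PropositionalEquality as ≡ using (_≡_; _≢_)
import Relation.Binary.Reasoning.Setoid
open import Relation.Nullary.Construct.Add.Supremum using ([_])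
open import Relation.Nullary.Decidable using (does; yes; no; ¬?; fromWitness)
open import Relation.Nullary.Negation using (¬_; contradiction)
open import Relation.Unary using (Pred) renaming (Decidable to Decidable₁)

-- The monoid ring stands in for the Witt vectors of F, and `I ^ K` for the ideal generated by
-- `p ^ K`: the elements [a] multiply like Teichmüller lifts, so power sums and Frobenius are exact
-- on them, without completion. The price is that `I` is larger than the ideal generated by `p`, so
-- that membership of an integer has to be turned back into divisibility; this is the purpose of δ.
--
-- The factor `e` in front of the ceiling is the delicate point, since digit sums alone only give e
-- m k / W before rounding. Replacing y by λ y, with λ a nonzero element of the subfield of order q,
-- multiplies y ^ q - y by λ. Accordingly, with each term of f counted as degree 1 and y as degree
-- 1, the polynomial f - y ^ q + y is homogeneous of degree 1 modulo q - 1. Its exponent (Q - 1) p ^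
-- K is divisible by q - 1, hence so is the degree of every product in the expansion. This
-- divisibility permits rounding up separately for each of the e multiplications by 1, p, ..., p ^
-- (e - 1) modulo q - 1.

module _ where
  open import Data.Nat.Base
  open import Data.Nat.ListAction using (sum)
  open import Data.Nat.Properties
  open import Data.Product.Base using (_×_)
  open import Relation.Binary.PropositionalEquality

  -- Sums of powers of b and multiples of b ^ r - 1.

  ∑ : ℕ → (ℕ → ℕ) → ℕ
  ∑ zero    f = 0
  ∑ (suc n) f = ∑ n f + f n

  ∑-cong : ∀ n {f g} → (∀ i → i < n → f i ≡ g i) → ∑ n f ≡ ∑ n g
  ∑-cong zero    eq = refl
  ∑-cong (suc n) eq = cong₂ _+_ (∑-cong n (λ i i<n → eq i (m<n⇒m<1+n i<n))) (eq n ≤-refl)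

  ∑-shift : ∀ n f → f 0 + ∑ n (f ∘ suc) ≡ ∑ n f + f n
  ∑-shift zero    f = +-comm (f 0) 0
  ∑-shift (suc n) f = trans (sym (+-assoc (f 0) _ _)) (cong (_+ f (suc n)) (∑-shift n f))

  ∑-distrib-+ : ∀ n f g → ∑ n (λ i → f i + g i) ≡ ∑ n f + ∑ n g
  ∑-distrib-+ zero    f g = refl
  ∑-distrib-+ (suc n) f g = trans (cong (_+ (f n + g n)) (∑-distrib-+ n f g))
    (solve 4 (λ a b c d → (a :+ b) :+ (c :+ d) := (a :+ c) :+ (b :+ d)) refl (∑ n f) (∑ n g) (f n) (g n))
    where open +-*-Solver

  ∑-zero : ∀ n → ∑ n (λ _ → 0) ≡ 0
  ∑-zero zero    = refl
  ∑-zero (suc n) = trans (+-identityʳ _) (∑-zero n)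

  ∑-lower : ∀ n {f c} → (∀ i → c ≤ f i) → n * c ≤ ∑ n f
  ∑-lower zero    c≤ = z≤n
  ∑-lower (suc n) {f} {c} c≤ = subst (_≤ ∑ (suc n) f) (+-comm (n * c) c) (+-mono-≤ (∑-lower n c≤) (c≤ n))

  geometric : ∀ b r .{{_ : NonZero b}} → suc (pred b * ∑ r (b ^_)) ≡ b ^ r
  geometric b zero    = cong suc (*-zeroʳ (pred b))
  geometric b (suc r) = begin
    suc (pred b * (G + b ^ r))         ≡⟨ cong suc (*-distribˡ-+ (pred b) G (b ^ r)) ⟩
    suc (pred b * G) + pred b * b ^ r  ≡⟨ cong (_+ pred b * b ^ r) (geometric b r) ⟩
    suc (pred b) * b ^ r               ≡⟨ cong (_* b ^ r) (suc-pred b) ⟩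
    b * b ^ r                          ∎
    where
    open ≡-Reasoning
    G = ∑ r (b ^_)

  pred-^ : ∀ b r .{{_ : NonZero b}} → pred (b ^ r) ≡ pred b * ∑ r (b ^_)
  pred-^ b r = cong pred (sym (geometric b r))

  ^-pred-∣ : ∀ b r c .{{_ : NonZero b}} → ∃[ d ] b ^ (c * r) ≡ 1 + pred (b ^ r) * d
  ^-pred-∣ b r c = ∑ c ((b ^ r) ^_) , (begin
    b ^ (c * r)                                ≡⟨ cong (b ^_) (*-comm c r) ⟩
    b ^ (r * c)                                ≡⟨ ^-*-assoc b r c ⟨
    (b ^ r) ^ c                                ≡⟨ geometric (b ^ r) c {{m^n≢0 b r}} ⟨
    suc (pred (b ^ r) * ∑ c ((b ^ r) ^_))      ∎)
    where open ≡-Reasoning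

  powerSum : ℕ → List ℕ → ℕ
  powerSum b es = sum (List.map (b ^_) es)

  module _ (b r : ℕ) .{{_ : NonZero b}} .{{_ : NonZero r}} where

    -- b ^ i * powerSum b es, with every power of b reduced modulo b ^ r - 1.
    cyclicSum : ℕ → List ℕ → ℕ
    cyclicSum i es = sum (List.map (λ l → b ^ ((i + l) % r)) es)

    -- Raising `l` by one drops the summand at 0 and appends the one at `r`; the two agree because
    -- exponents are read modulo `r`. This replaces a permutation of the indices.
    ∑-rotate : ∀ l → ∑ r (λ i → b ^ ((i + l) % r)) ≡ ∑ r (b ^_)
    ∑-rotate zero = ∑-cong r λ i i<r →
      cong (b ^_) (trans (cong (_% r) (+-identityʳ i)) (m<n⇒m%n≡m i<r))
    ∑-rotate (suc l) = trans (∑-cong r λ i _ → cong (λ n → b ^ (n % r)) (+-suc i l))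
      (trans (+-cancelˡ-≡ (f 0) _ _ (trans (∑-shift r f) (trans (cong (∑ r f +_) fr≡f0) (+-comm (∑ r f) (f 0)))))
             (∑-rotate l))
      where
      f : ℕ → ℕ
      f i = b ^ ((i + l) % r)
      fr≡f0 : f r ≡ f 0
      fr≡f0 = cong (b ^_) (trans (cong (_% r) (+-comm r l)) ([m+n]%n≡m%n l r))

    ∑-cyclicSum : ∀ es → ∑ r (λ i → cyclicSum i es) ≡ length es * ∑ r (b ^_)
    ∑-cyclicSum []       = ∑-zero r
    ∑-cyclicSum (l ∷ es) = trans (∑-distrib-+ r (λ i → b ^ ((i + l) % r)) _) (cong₂ _+_ (∑-rotate l) (∑-cyclicSum es))

    cyclic-reduce : ∀ i l → ∃[ c ] b ^ i * b ^ l ≡ b ^ ((i + l) % r) + pred (b ^ r) * c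
    cyclic-reduce i l = let d , eq = ^-pred-∣ b r ((i + l) / r) in b ^ s * d , (begin
      b ^ i * b ^ l                           ≡⟨ ^-distribˡ-+-* b i l ⟨
      b ^ (i + l)                             ≡⟨ cong (b ^_) (m≡m%n+[m/n]*n (i + l) r) ⟩
      b ^ (s + (i + l) / r * r)               ≡⟨ ^-distribˡ-+-* b s _ ⟩
      b ^ s * b ^ ((i + l) / r * r)           ≡⟨ cong (b ^ s *_) eq ⟩
      b ^ s * (1 + pred (b ^ r) * d)          ≡⟨ solve 3 (λ x y z → x :* (con 1 :+ y :* z) := x :+ y :* (x :* z)) refl (b ^ s) (pred (b ^ r)) d ⟩
      b ^ s + pred (b ^ r) * (b ^ s * d)      ∎)
      where
      open ≡-Reasoning
      open +-*-Solver
      s = (i + l) % r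

    cyclicSum-≡ : ∀ i es → ∃[ c ] b ^ i * powerSum b es ≡ cyclicSum i es + pred (b ^ r) * c
    cyclicSum-≡ i []       = 0 , trans (*-zeroʳ (b ^ i)) (sym (*-zeroʳ (pred (b ^ r))))
    cyclicSum-≡ i (l ∷ es) = let c , eq = cyclic-reduce i l ; c′ , eq′ = cyclicSum-≡ i es in
      c + c′ , trans (*-distribˡ-+ (b ^ i) (b ^ l) _) (trans (cong₂ _+_ eq eq′)
        (solve 5 (λ x y z u v → (x :+ y :* z) :+ (u :+ y :* v) := (x :+ u) :+ y :* (z :+ v)) refl
          (b ^ ((i + l) % r)) (pred (b ^ r)) c (cyclicSum i es) c′))
      where open +-*-Solver

    ∣-cyclicSum : ∀ i es → pred (b ^ r) ∣ powerSum b es → pred (b ^ r) ∣ cyclicSum i es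
    ∣-cyclicSum i es D∣ = let c , eq = cyclicSum-≡ i es in
      ∣m+n∣n⇒∣m (subst (pred (b ^ r) ∣_) eq (∣n⇒∣m*n (b ^ i) D∣)) (m∣m*n c)
      where
      ∣m+n∣n⇒∣m : ∀ {i m n} → i ∣ m + n → i ∣ n → i ∣ m
      ∣m+n∣n⇒∣m {i} {m} {n} i∣ = ∣m+n∣m⇒∣n (subst (i ∣_) (+-comm m n) i∣)

    -- Each of the r cyclic shifts of the sum is a positive multiple of
    -- b ^ r - 1, while together they contribute 1 + b + ⋯ + b ^ (r - 1) per summand.
    powerSum-length : .{{NonTrivial b}} → ∀ es → NonZero (length es) →
                      pred (b ^ r) ∣ powerSum b es → r * pred b ≤ length es
    powerSum-length (l ∷ es) _ D∣ = *-cancelʳ-≤ _ _ G {{>-nonZero G>0}} (begin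
        r * pred b * G                     ≡⟨ *-assoc r (pred b) G ⟩
        r * (pred b * G)                   ≡⟨ cong (r *_) (pred-^ b r) ⟨
        r * pred (b ^ r)                   ≤⟨ ∑-lower r (λ i → ∣⇒≤ {{σ≢0 i}} (∣-cyclicSum i (l ∷ es) D∣)) ⟩
        ∑ r (λ i → cyclicSum i (l ∷ es))   ≡⟨ ∑-cyclicSum (l ∷ es) ⟩
        length (l ∷ es) * G                ∎)
      where
      open ≤-Reasoning
      G = ∑ r (b ^_)
      σ≢0 : ∀ i → NonZero (cyclicSum i (l ∷ es))
      σ≢0 i = >-nonZero (≤-trans (m^n>0 b ((i + l) % r)) (m≤m+n _ _))
      G>0 : 0 < G
      G>0 = n≢0⇒n>0 λ G≡0 → <-irrefl
        (trans (cong suc (sym (trans (cong (pred b *_) G≡0) (*-zeroʳ (pred b))))) (geometric b r))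
        (≤-trans (nonTrivial⇒n>1 b) (subst (_≤ b ^ r) (^-identityʳ b) (^-monoʳ-≤ b {1} {r} (>-nonZero⁻¹ r))))

  -- A carry-free way to say that the base `b` digit sum of `n` is at most `s`: exponents may
  -- repeat, so sums are formed by concatenating lists, whereas the digit sum itself is only
  -- subadditive.
  IsPowerSum : ℕ → ℕ → ℕ → Set
  IsPowerSum b s n = ∃[ es ] length es ≡ s × powerSum b es ≡ n

  module _ {b : ℕ} where

    isPowerSum-+ : ∀ {s s′ n n′} → IsPowerSum b s n → IsPowerSum b s′ n′ → IsPowerSum b (s + s′) (n + n′)
    isPowerSum-+ (es , refl , refl) (es′ , refl , refl) =
      es ++ es′ , List.length-++ es ,
      trans (cong sum (List.map-++ (b ^_) es es′)) (sum-++ (List.map (b ^_) es) _)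

    isPowerSum-* : ∀ {s n} c → IsPowerSum b s n → IsPowerSum b (c * s) (c * n)
    isPowerSum-* zero    _ = [] , refl , refl
    isPowerSum-* (suc c) P = isPowerSum-+ P (isPowerSum-* c P)

    isPowerSum-shift : ∀ {s n} c → IsPowerSum b s n → IsPowerSum b s (b ^ c * n)
    isPowerSum-shift c (es , refl , refl) = List.map (c +_) es , List.length-map (c +_) es , shift es
      where
      shift : ∀ es → powerSum b (List.map (c +_) es) ≡ b ^ c * powerSum b es
      shift []       = sym (*-zeroʳ (b ^ c))
      shift (l ∷ es) = trans (cong₂ _+_ (^-distribˡ-+-* b c l) (shift es)) (sym (*-distribˡ-+ (b ^ c) (b ^ l) _))

    isPowerSum-ones : ∀ c → IsPowerSum b c c
    isPowerSum-ones c = subst (λ s → IsPowerSum b s s) (*-identityʳ c) (isPowerSum-* c (0 ∷ [] , refl , refl))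

  isPowerSum-fromDigits : ∀ {b} (ds : Expansion b) → IsPowerSum b (sum (List.map Fin.toℕ ds)) (fromDigits ds)
  isPowerSum-fromDigits []           = [] , refl , refl
  isPowerSum-fromDigits {b} (d ∷ ds) = isPowerSum-+ (isPowerSum-ones (Fin.toℕ d))
    (subst (IsPowerSum b _) (trans (cong (_* fromDigits ds) (^-identityʳ b)) (*-comm b (fromDigits ds)))
           (isPowerSum-shift 1 (isPowerSum-fromDigits ds)))

  isPowerSum-digitSum : ∀ q n .{{_ : NonTrivial q}} → IsPowerSum q (digitSum q n) n
  isPowerSum-digitSum q n = subst (IsPowerSum q (digitSum q n))
    (proj₂ (toDigits q {fromWitness (nonTrivial⇒n>1 q)} n)) (isPowerSum-fromDigits (digits q n))

  ⌈/⌉-least : ∀ a b c .{{_ : NonZero b}} → a ≤ c * b → ⌈ a / b ⌉ ≤ c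
  ⌈/⌉-least a b c a≤cb = s≤s⁻¹ (m<n*o⇒m/o<n {a + pred b} {suc c} {b} (begin-strict
    a + pred b       <⟨ +-mono-≤-< a≤cb (≤-reflexive (suc-pred b)) ⟩
    c * b + b        ≡⟨ +-comm (c * b) b ⟩
    suc c * b        ∎))
    where open ≤-Reasoning

  ⌈/⌉-upper : ∀ a b .{{_ : NonZero b}} → a ≤ ⌈ a / b ⌉ * b
  ⌈/⌉-upper a b = +-cancelʳ-≤ (pred b) _ _ (begin
    a + pred b                                     ≡⟨ m≡m%n+[m/n]*n (a + pred b) b ⟩
    (a + pred b) % b + ⌈ a / b ⌉ * b               ≤⟨ +-monoˡ-≤ _ (pred-mono-≤ (m%n<n (a + pred b) b)) ⟩
    pred b + ⌈ a / b ⌉ * b                         ≡⟨ +-comm (pred b) _ ⟩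
    ⌈ a / b ⌉ * b + pred b                         ∎)
    where
    open ≤-Reasoning
    open import Data.Nat.DivMod using (m%n<n)

  module ℕ-Sum = Algebra.Properties.CommutativeMonoid.Sum +-0-commutativeMonoid

  sumFin-mono : ∀ {n} {f g : Fin n → ℕ} → (∀ j → f j ≤ g j) → ℕ-Sum.sum f ≤ ℕ-Sum.sum g
  sumFin-mono {zero}  f≤g = z≤n
  sumFin-mono {suc n} f≤g = +-mono-≤ (f≤g zero) (sumFin-mono (f≤g ∘ suc))

  sumFin-*ˡ : ∀ {n} c (f : Fin n → ℕ) → ℕ-Sum.sum (λ j → c * f j) ≡ c * ℕ-Sum.sum f
  sumFin-*ˡ {zero}  c f = sym (*-zeroʳ c)
  sumFin-*ˡ {suc n} c f = trans (cong (c * f zero +_) (sumFin-*ˡ c (f ∘ suc))) (sym (*-distribˡ-+ c (f zero) _))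

  -- Marks a variable with exponent 0, whose power sum over the field is `q ^ m` and therefore
  -- contributes `e * m` powers of `I`.
  isZero : ℕ → ℕ
  isZero zero    = 1
  isZero (suc _) = 0

  isZero-complement : ∀ n → isZero n + (1 ∸ isZero n) ≡ 1
  isZero-complement zero    = refl
  isZero-complement (suc _) = refl

  -- Digit sums of the exponents in a product of terms.

  module _ (p e m : ℕ) .{{_ : NonTrivial p}} .{{_ : NonZero e}} .{{_ : NonZero m}}
           .{{_ : NonTrivial (p ^ e)}} where

    private
      instance
        p≢0 : NonZero p
        p≢0 = nonTrivial⇒nonZero p
        q≢0 : NonZero (p ^ e)
        q≢0 = nonTrivial⇒nonZero (p ^ e)

      q = p ^ e

    -- A pair `(t , l)` stands for the `p ^ l`-th power of the monomial with exponent vector `t`,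
    -- and `ts` for the product of all of them.
    exponent : ∀ {k} → Fin k → List (Vec ℕ k × ℕ) → ℕ
    exponent j ts = sum (List.map (λ (t , l) → p ^ l * lookup t j) ts)

    vanishing : ∀ {k} → List (Vec ℕ k × ℕ) → ℕ
    vanishing ts = ℕ-Sum.sum (λ j → isZero (exponent j ts))

    private
      module _ {k : ℕ} where

        -- The exponent sum Σ p ^ l of `ts` times `p ^ i`, with every power of p reduced modulo
        -- `q - 1`.
        A : ℕ → List (Vec ℕ k × ℕ) → ℕ
        A i ts = cyclicSum p e i (List.map proj₂ ts)

        -- Bounds the base `q` digit sum of `p ^ i` times the exponent of variable `j`. In
        -- `p ^ (i + l)` the full multiples of `e` form a power of `q`, which leaves digit sums
        -- unchanged; only the remainder costs a factor.
        digitCost : ℕ → Fin k → List (Vec ℕ k × ℕ) → ℕ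
        digitCost i j ts = sum (List.map (λ (t , l) → p ^ ((i + l) % e) * digitSum q (lookup t j)) ts)

        isPowerSum-exponent : ∀ i j ts → IsPowerSum q (digitCost i j ts) (p ^ i * exponent j ts)
        isPowerSum-exponent i j [] = [] , refl , sym (*-zeroʳ (p ^ i))
        isPowerSum-exponent i j ((t , l) ∷ ts) = subst (IsPowerSum q _) eq
          (isPowerSum-+ (isPowerSum-* (p ^ s) (isPowerSum-shift c (isPowerSum-digitSum q (lookup t j))))
                        (isPowerSum-exponent i j ts))
          where
          open ≡-Reasoning
          open +-*-Solver
          s = (i + l) % e
          c = (i + l) / e
          p^ : p ^ s * q ^ c ≡ p ^ i * p ^ l
          p^ = begin
            p ^ s * q ^ c         ≡⟨ cong (p ^ s *_) (trans (^-*-assoc p e c) (cong (p ^_) (*-comm e c))) ⟩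
            p ^ s * p ^ (c * e)   ≡⟨ ^-distribˡ-+-* p s (c * e) ⟨
            p ^ (s + c * e)       ≡⟨ cong (p ^_) (m≡m%n+[m/n]*n (i + l) e) ⟨
            p ^ (i + l)           ≡⟨ ^-distribˡ-+-* p i l ⟩
            p ^ i * p ^ l         ∎
          eq : p ^ s * (q ^ c * lookup t j) + p ^ i * exponent j ts ≡ p ^ i * exponent j ((t , l) ∷ ts)
          eq = begin
            p ^ s * (q ^ c * lookup t j) + p ^ i * exponent j ts  ≡⟨ cong (_+ p ^ i * exponent j ts) (*-assoc (p ^ s) (q ^ c) _) ⟨
            p ^ s * q ^ c * lookup t j + p ^ i * exponent j ts    ≡⟨ cong (λ n → n * lookup t j + p ^ i * exponent j ts) p^ ⟩
            p ^ i * p ^ l * lookup t j + p ^ i * exponent j ts    ≡⟨ solve 4 (λ a b c d → a :* b :* c :+ a :* d := a :* (b :* c :+ d)) refl (p ^ i) (p ^ l) (lookup t j) (exponent j ts) ⟩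
            p ^ i * exponent j ((t , l) ∷ ts)                     ∎

        -- A positive exponent divisible by `q ^ m - 1` remains so after multiplication by `p ^ i`,
        -- and a positive multiple of `q ^ m - 1` is never a sum of fewer than `m * (q - 1)` powers
        -- of `q`. For exponent 0 the bound reads 0.
        digitCost-lower : ∀ i j ts → pred (q ^ m) ∣ exponent j ts →
                          m * pred q * (1 ∸ isZero (exponent j ts)) ≤ digitCost i j ts
        digitCost-lower i j ts D∣u with exponent j ts in eq
        ... | zero  = subst (_≤ digitCost i j ts) (sym (*-zeroʳ (m * pred q))) z≤n
        ... | suc n = lower (isPowerSum-exponent i j ts)
          where
          lower : IsPowerSum q (digitCost i j ts) (p ^ i * exponent j ts) →
                  m * pred q * 1 ≤ digitCost i j ts
          lower ([] , _ , 0≡) = contradiction (trans 0≡ (cong (p ^ i *_) eq))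
            (≢-sym (≢-nonZero⁻¹ _ {{m*n≢0 (p ^ i) (suc n) {{m^n≢0 p i}}}}))
          lower (es@(_ ∷ _) , len , ≡u) = subst₂ _≤_ (sym (*-identityʳ _)) len
            (powerSum-length q m es _ (subst (pred (q ^ m) ∣_) (sym (trans ≡u (cong (p ^ i *_) eq))) (∣n⇒∣m*n (p ^ i) D∣u)))

        S-sum : ∀ {k} (t : Vec ℕ k) → S q t ≡ ℕ-Sum.sum (λ j → digitSum q (lookup t j))
        S-sum []      = refl
        S-sum (n ∷ t) = cong (digitSum q n +_) (S-sum t)

        -- Summed over the variables, the digit sums of the coordinates of one `t` make up `S q t`,
        -- while the factors `p ^ ((i + l) % e)` add up to `A i ts`.
        digitCost-upper : ∀ {W} i ts → All (λ (t , _) → S q t ≤ W) ts →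
                          ℕ-Sum.sum (λ j → digitCost i j ts) ≤ A i ts * W
        digitCost-upper {W} i [] _ = ≤-reflexive (ℕ-Sum.sum-replicate-zero k)
        digitCost-upper {W} i ((t , l) ∷ ts) (S≤W ∷ Ss≤W) = begin
          ℕ-Sum.sum (λ j → c * digitSum q (lookup t j) + digitCost i j ts)
            ≡⟨ ℕ-Sum.∑-distrib-+ (λ j → c * digitSum q (lookup t j)) (λ j → digitCost i j ts) ⟩
          ℕ-Sum.sum (λ j → c * digitSum q (lookup t j)) + ℕ-Sum.sum (λ j → digitCost i j ts)
            ≡⟨ cong (_+ _) (trans (sumFin-*ˡ c (λ j → digitSum q (lookup t j))) (cong (c *_) (sym (S-sum t)))) ⟩
          c * S q t + ℕ-Sum.sum (λ j → digitCost i j ts)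
            ≤⟨ +-mono-≤ (*-monoʳ-≤ c S≤W) (digitCost-upper i ts Ss≤W) ⟩
          c * W + A i ts * W
            ≡⟨ *-distribʳ-+ W c (A i ts) ⟨
          A i ((t , l) ∷ ts) * W ∎
          where
          open ≤-Reasoning
          c = p ^ ((i + l) % e)

    private
      vanishing-complement : ∀ {k} (ts : List (Vec ℕ k × ℕ)) →
                             vanishing ts + ℕ-Sum.sum (λ j → 1 ∸ isZero (exponent j ts)) ≡ k
      vanishing-complement {k} ts = trans (sym (ℕ-Sum.∑-distrib-+ (λ j → isZero (exponent j ts)) _))
        (trans (ℕ-Sum.sum-cong-≗ (λ j → isZero-complement (exponent j ts))) (ones k))
        where
        ones : ∀ k → ℕ-Sum.sum {k} (λ _ → 1) ≡ k
        ones zero    = refl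
        ones (suc k) = cong suc (ones k)

    -- Each of the e cyclic shifts of the exponent sum of ts is a multiple of
    -- q - 1 that is at least m (q - 1) (number of occurring variables) / W, and
    -- rounding up can be done separately for every shift; this is where the
    -- factor e in front of the ceiling comes from.
    length-lower : ∀ {k W} .{{_ : NonZero W}} (ts : List (Vec ℕ k × ℕ)) → All (λ (t , _) → S q t ≤ W) ts →
                   pred q ∣ powerSum p (List.map proj₂ ts) →
                   (∀ j → pred (q ^ m) ∣ exponent j ts) →
                   e * ⌈ m * k / W ⌉ * pred p ≤ length ts + e * (m * vanishing ts) * pred p
    length-lower {k} {W} ts S≤W q-1∣ D∣ = begin
      e * ⌈ m * k / W ⌉ * pred p               ≤⟨ *-monoˡ-≤ (pred p) (*-monoʳ-≤ e (⌈/⌉-least (m * k) W (u + m * z) mk≤)) ⟩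
      e * (u + m * z) * pred p                 ≡⟨ cong (_* pred p) (*-distribˡ-+ e u (m * z)) ⟩
      (e * u + e * (m * z)) * pred p           ≡⟨ *-distribʳ-+ (pred p) (e * u) (e * (m * z)) ⟩
      e * u * pred p + e * (m * z) * pred p    ≤⟨ +-monoˡ-≤ _ eu≤ ⟩
      length ts + e * (m * z) * pred p         ∎
      where
      open ≤-Reasoning
      z  = vanishing ts
      nz = ℕ-Sum.sum (λ j → 1 ∸ isZero (exponent j ts))
      u  = ⌈ m * nz / W ⌉
      G  = ∑ e (p ^_)

      -- Since `W ≥ 1`, an absent variable may be credited with `m` instead of `m / W`.
      mk≤ : m * k ≤ (u + m * z) * W
      mk≤ = begin
        m * k              ≡⟨ cong (m *_) (vanishing-complement ts) ⟨
        m * (z + nz)       ≡⟨ trans (*-distribˡ-+ m z nz) (+-comm (m * z) (m * nz)) ⟩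
        m * nz + m * z     ≤⟨ +-mono-≤ (⌈/⌉-upper (m * nz) W) (m≤m*n (m * z) W) ⟩
        u * W + m * z * W  ≡⟨ *-distribʳ-+ W u (m * z) ⟨
        (u + m * z) * W    ∎

      instance
        q-1≢0 : NonZero (pred q)
        q-1≢0 = >-nonZero (pred-mono-≤ (nonTrivial⇒n>1 q))

      u≤A : ∀ i → u * pred q ≤ A i ts
      u≤A i with ∣-cyclicSum p e i (List.map proj₂ ts) q-1∣
      -- Divisibility by `q - 1` makes `B` an integer, so `m * nz ≤ B * W` gives the rounded bound
      -- `u ≤ B`.
      ... | divides B eq = subst (u * pred q ≤_) (sym eq) (*-monoˡ-≤ (pred q) (⌈/⌉-least (m * nz) W B
        (*-cancelʳ-≤ _ _ (pred q) (begin
          m * nz * pred q                                               ≡⟨ solve 3 (λ a b c → a :* b :* c := a :* c :* b) refl m nz (pred q) ⟩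
          m * pred q * nz                                               ≡⟨ sumFin-*ˡ (m * pred q) (λ j → 1 ∸ isZero (exponent j ts)) ⟨
          ℕ-Sum.sum (λ j → m * pred q * (1 ∸ isZero (exponent j ts)))   ≤⟨ sumFin-mono (λ j → digitCost-lower i j ts (D∣ j)) ⟩
          ℕ-Sum.sum (λ j → digitCost i j ts)                            ≤⟨ digitCost-upper i ts S≤W ⟩
          A i ts * W                                                    ≡⟨ cong (_* W) eq ⟩
          B * pred q * W                                                ≡⟨ solve 3 (λ a b c → a :* b :* c := a :* c :* b) refl B (pred q) W ⟩
          B * W * pred q                                                ∎))))
        where open +-*-Solver

      G≢0 : NonZero G
      G≢0 = ≢-nonZero λ G≡0 → ≢-nonZero⁻¹ (pred q)
        (trans (pred-^ p e) (trans (cong (pred p *_) G≡0) (*-zeroʳ (pred p))))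

      -- In the sum over all shifts every factor of `ts` contributes `G`, and `q - 1` equals
      -- `(p - 1) * G`; cancelling `G` leaves a bound on the number of factors.
      eu≤ : e * u * pred p ≤ length ts
      eu≤ = *-cancelʳ-≤ _ _ G {{G≢0}} (begin
        e * u * pred p * G                          ≡⟨ trans (*-assoc (e * u) (pred p) G) (*-assoc e u _) ⟩
        e * (u * (pred p * G))                      ≡⟨ cong (λ n → e * (u * n)) (pred-^ p e) ⟨
        e * (u * pred q)                            ≤⟨ ∑-lower e u≤A ⟩
        ∑ e (λ i → A i ts)                          ≡⟨ ∑-cyclicSum p e (List.map proj₂ ts) ⟩
        length (List.map proj₂ ts) * G              ≡⟨ cong (_* G) (List.length-map proj₂ ts) ⟩
        length ts * G                               ∎)

    -- The right-hand side is the power of `I` collected by one product: `v` from its coefficient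
    -- and `e * m` from each absent variable, `y` included. If `y` occurs, its exponent consumes at
    -- least `e * m * (p - 1)` powers of p, that is, all the factors not paid for by `v`; if not,
    -- these factors are offset by the power sum of `y`. Since `q - 1` divides both the total degree
    -- and the exponent of `y`, it divides the degree of the remaining part, to which `length-lower`
    -- applies.
    weight-estimate : ∀ {k W v} .{{_ : NonZero W}} (ts : List (Vec ℕ k × ℕ)) (ls : List ℕ) →
      All (λ (t , _) → S q t ≤ W) ts →
      length ts + length ls ≤ (e * m + v) * pred p →
      pred q ∣ powerSum p (List.map proj₂ ts) + powerSum p ls →
      (∀ j → pred (q ^ m) ∣ exponent j ts) → pred (q ^ m) ∣ powerSum p ls →
      e * ⌈ m * k / W ⌉ ≤ v + e * m * (isZero (powerSum p ls) + vanishing ts)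
    weight-estimate {k} {W} {v} ts ls S≤W len q-1∣ D∣ D∣y = *-cancelʳ-≤ _ _ (pred p) {{>-nonZero (pred-mono-≤ (nonTrivial⇒n>1 p))}} (begin
      e * ⌈ m * k / W ⌉ * pred p                                  ≤⟨ length-lower ts S≤W q-1∣ts D∣ ⟩
      length ts + e * (m * z) * pred p                            ≤⟨ +-monoˡ-≤ _ (length≤ ls len D∣y) ⟩
      (v + e * m * y) * pred p + e * (m * z) * pred p             ≡⟨ solve 6 (λ v e m y z c → (v :+ e :* m :* y) :* c :+ e :* (m :* z) :* c := (v :+ e :* m :* (y :+ z)) :* c) refl v e m y z (pred p) ⟩
      (v + e * m * (y + z)) * pred p                              ∎)
      where
      open ≤-Reasoning
      open +-*-Solver
      z = vanishing ts
      y = isZero (powerSum p ls)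

      q-1∣Q-1 : pred q ∣ pred (q ^ m)
      q-1∣Q-1 = subst (pred q ∣_) (sym (pred-^ q m)) (m∣m*n _)

      q-1∣ts : pred q ∣ powerSum p (List.map proj₂ ts)
      q-1∣ts = ∣m+n∣m⇒∣n (subst (pred q ∣_) (+-comm (powerSum p (List.map proj₂ ts)) _) q-1∣) (∣-trans q-1∣Q-1 D∣y)

      length≤ : ∀ ls → length ts + length ls ≤ (e * m + v) * pred p → pred (q ^ m) ∣ powerSum p ls →
                length ts ≤ (v + e * m * isZero (powerSum p ls)) * pred p
      length≤ [] len _ = subst₂ _≤_ (+-identityʳ _)
        (cong (_* pred p) (trans (+-comm (e * m) v) (cong (v +_) (sym (*-identityʳ (e * m)))))) len
      length≤ ls@(l ∷ _) len D∣y = ≤-trans (+-cancelˡ-≤ (e * m * pred p) _ _ (begin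
        e * m * pred p + length ts  ≤⟨ +-monoˡ-≤ _ (powerSum-length p (e * m) {{p≢0}} {{m*n≢0 e m}} ls _
                                         (subst (λ n → pred n ∣ powerSum p ls) (^-*-assoc p e m) D∣y)) ⟩
        length ls + length ts       ≡⟨ +-comm (length ls) (length ts) ⟩
        length ts + length ls       ≤⟨ len ⟩
        (e * m + v) * pred p        ≡⟨ *-distribʳ-+ (pred p) (e * m) v ⟩
        e * m * pred p + v * pred p ∎)) (*-monoˡ-≤ (pred p) (m≤m+n v _))

-- Binomial coefficients and the p-th power of a sum.

C-absorption : ∀ n k → suc k ℕ.* (suc n C suc k) ≡ suc n ℕ.* (n C k)
C-absorption zero    zero    = ≡.refl
C-absorption zero    (suc k) = ℕ.*-zeroʳ k
C-absorption (suc n) zero    = ≡.trans (ℕ.*-identityˡ _) (≡.trans (nC1≡n (suc (suc n))) (≡.sym (ℕ.*-identityʳ _)))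
C-absorption (suc n) (suc k) = begin
  suc (suc k) ℕ.* (suc (suc n) C suc (suc k))
    ≡⟨ ≡.cong (suc (suc k) ℕ.*_) (nCk+nC[k+1]≡[n+1]C[k+1] (suc n) (suc k)) ⟨
  suc (suc k) ℕ.* (a ℕ.+ (suc n C suc (suc k)))
    ≡⟨ ℕ.*-distribˡ-+ (suc (suc k)) a _ ⟩
  (a ℕ.+ suc k ℕ.* a) ℕ.+ suc (suc k) ℕ.* (suc n C suc (suc k))
    ≡⟨ ≡.cong₂ (λ u v → (a ℕ.+ u) ℕ.+ v) (C-absorption n k) (C-absorption n (suc k)) ⟩
  (a ℕ.+ suc n ℕ.* (n C k)) ℕ.+ suc n ℕ.* (n C suc k)
    ≡⟨ ≡.trans (ℕ.+-assoc a _ _) (≡.cong (a ℕ.+_) (≡.sym (ℕ.*-distribˡ-+ (suc n) (n C k) _))) ⟩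
  a ℕ.+ suc n ℕ.* ((n C k) ℕ.+ (n C suc k))
    ≡⟨ ≡.cong (λ u → a ℕ.+ suc n ℕ.* u) (nCk+nC[k+1]≡[n+1]C[k+1] n k) ⟩
  a ℕ.+ suc n ℕ.* a ∎
  where
  open ≡.≡-Reasoning
  a = suc n C suc k

prime∣C : ∀ {p} → Prime p → ∀ k → suc k < p → p ∣ p C suc k
prime∣C {suc n} pr k k<p with euclidsLemma (suc k) (suc n C suc k) pr
                              (divides (n C k) (≡.trans (C-absorption n k) (ℕ.*-comm (suc n) (n C k))))
... | inj₁ p∣k = contradiction (∣⇒≤ p∣k) (ℕ.<⇒≱ k<p)
... | inj₂ p∣C = p∣C

module Frobenius {c ℓ} (R : CommutativeRing c ℓ) where
  open CommutativeRing R hiding (zero)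
  open Algebra.Properties.CommutativeSemiring.Exp commutativeSemiring
  open Algebra.Properties.Semiring.Mult semiring
  open Algebra.Properties.Semiring.Sum semiring
  open Relation.Binary.Reasoning.Setoid setoid
  private module Bin = Algebra.Properties.CommutativeSemiring.Binomial commutativeSemiring

  ι : ℕ → Carrier
  ι n = n × 1#

  ×-ι : ∀ n x → n × x ≈ ι n * x
  ×-ι n x = trans (×-congʳ n (sym (*-identityˡ x))) (sym (×-assoc-* n 1# x))

  ι-* : ∀ m n → ι (m ℕ.* n) ≈ ι m * ι n
  ι-* = ×1-homo-*

  ι-^ : ∀ m n → ι (m ℕ.^ n) ≈ ι m ^ n
  ι-^ m zero    = +-identityʳ 1#
  ι-^ m (suc n) = trans (ι-* m (m ℕ.^ n)) (*-congˡ (ι-^ m n))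

  1#^ : ∀ n → 1# ^ n ≈ 1#
  1#^ zero    = refl
  1#^ (suc n) = trans (*-identityˡ _) (1#^ n)

  0#^ : ∀ n .{{_ : NonZero n}} → 0# ^ n ≈ 0#
  0#^ (suc n) = zeroˡ _

  -- The terms of ((x + y) ^ p - x ^ p - y ^ p) / p, with the division carried out in the binomial
  -- coefficients and hence meaningful in every commutative ring.
  crossTerm : (p : ℕ) .{{_ : NonZero p}} → Carrier → Carrier → Fin (pred p) → Carrier
  crossTerm p x y i = ((p C suc (toℕ i)) ℕ./ p) × (x ^ suc (toℕ i) * y ^ (p ∸ suc (toℕ i)))

  cross : (p : ℕ) .{{_ : NonZero p}} → Carrier → Carrier → Carrier
  cross p x y = sum (crossTerm p x y)

  frobenius : ∀ {p} (pr : Prime p) → let instance _ = prime⇒nonZero pr in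
              ∀ x y → (x + y) ^ p ≈ x ^ p + y ^ p + ι p * cross p x y
  frobenius {p@(suc n)} pr x y = begin
    (x + y) ^ p                                    ≈⟨ Bin.theorem p x y ⟩
    t zero + sum (t ∘ suc)                         ≈⟨ +-cong first (sum-init-last (t ∘ suc)) ⟩
    y ^ p + (sum (λ i → t (suc (Fin.inject₁ i))) + t (suc (Fin.fromℕ n)))
      ≈⟨ +-congˡ (+-cong (sum-cong-≋ middle) last) ⟩
    y ^ p + (sum (λ i → ι p * crossTerm p x y i) + x ^ p)
      ≈⟨ +-congˡ (+-congʳ (sym (*-distribˡ-sum (ι p) (crossTerm p x y)))) ⟩
    y ^ p + (ι p * cross p x y + x ^ p)
      ≈⟨ solve 3 (λ a b c → a :+ (b :+ c) := c :+ a :+ b) refl (y ^ p) (ι p * cross p x y) (x ^ p) ⟩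
    x ^ p + y ^ p + ι p * cross p x y              ∎
    where
    open Algebra.Solver.Ring.NaturalCoefficients.Default commutativeSemiring using (solve; _:+_; _:=_)
    t : Fin (suc p) → Carrier
    t = Bin.binomialTerm x y p
    first : t zero ≈ y ^ p
    first = trans (×-homo-1 _) (*-identityˡ _)
    last : t (suc (Fin.fromℕ n)) ≈ x ^ p
    last = begin
      (p C suc (toℕ (Fin.fromℕ n))) × (x ^ suc (toℕ (Fin.fromℕ n)) * y ^ (p ∸ suc (toℕ (Fin.fromℕ n))))
        ≡⟨ ≡.cong (λ k → (p C suc k) × (x ^ suc k * y ^ (p ∸ suc k))) (Fin.toℕ-fromℕ n) ⟩
      (p C p) × (x ^ p * y ^ (n ∸ n))
        ≡⟨ ≡.cong₂ (λ a b → a × (x ^ p * y ^ b)) (nCn≡1 p) (ℕ.n∸n≡0 n) ⟩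
      1 × (x ^ p * 1#)  ≈⟨ trans (×-homo-1 _) (*-identityʳ _) ⟩
      x ^ p             ∎
    middle : ∀ i → t (suc (Fin.inject₁ i)) ≈ ι p * crossTerm p x y i
    middle i = begin
      t (suc (Fin.inject₁ i))
        ≡⟨ ≡.cong (λ k → (p C suc k) × (x ^ suc k * y ^ (p ∸ suc k))) (Fin.toℕ-inject₁ i) ⟩
      (p C k) × z                        ≡⟨ ≡.cong (_× z) (m*[n/m]≡n (prime∣C pr (toℕ i) (s≤s (Fin.toℕ<n i)))) ⟨
      (p ℕ.* ((p C k) ℕ./ p)) × z        ≈⟨ ×-assocˡ z p ((p C k) ℕ./ p) ⟨
      p × crossTerm p x y i              ≈⟨ ×-ι p _ ⟩
      ι p * crossTerm p x y i            ∎
      where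
      k = suc (toℕ i)
      z = x ^ k * y ^ (p ∸ k)

-- Powers of the kernel of a ring homomorphism, and the operation δ.

module IdealPowers {a ℓ f ℓ′} (R : CommutativeRing a ℓ) (F : CommutativeRing f ℓ′)
  {ε : CommutativeRing.Carrier R → CommutativeRing.Carrier F}
  (ε-homo : IsRingHomomorphism (CommutativeRing.rawRing R) (CommutativeRing.rawRing F) ε) where

  open CommutativeRing R hiding (zero)
  open Algebra.Properties.CommutativeSemiring.Exp commutativeSemiring
  open Algebra.Properties.Semiring.Mult semiring
  open Algebra.Properties.Semiring.Sum semiring
  open Algebra.Properties.Ring ring using (-1*x≈-x)
  open Relation.Binary.Reasoning.Setoid setoid
  open Frobenius R
  open Algebra.Solver.Ring.NaturalCoefficients.Default commutativeSemiring using (solve; _:+_; _:*_; _:=_)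
  private module F = CommutativeRing F
  open IsRingHomomorphism ε-homo

  record Kernel (x : Carrier) : Set ℓ′ where
    constructor kernel
    field ε≈0 : ε x F.≈ F.0#

  Kernel-* : ∀ {x} y → Kernel x → Kernel (x * y)
  Kernel-* y (kernel εx≈0) = kernel (F.trans (*-homo _ y) (F.trans (F.*-congʳ εx≈0) (F.zeroˡ (ε y))))

  infix 4 _∈I^_
  -- Inductive, so that `δ-lowers` can recurse on how an element arises from kernel elements. The
  -- innermost cofactor is arbitrary by `all`, which already gives closure under multiplication by
  -- ring elements.
  data _∈I^_ : Carrier → ℕ → Set (a ⊔ ℓ ⊔ ℓ′) where
    all     : ∀ {x} → x ∈I^ 0
    product : ∀ {n x y} → Kernel x → y ∈I^ n → (x * y) ∈I^ suc n
    plus    : ∀ {n x y} → x ∈I^ n → y ∈I^ n → (x + y) ∈I^ n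
    resp    : ∀ {n x y} → x ≈ y → x ∈I^ n → y ∈I^ n

  Kernel-resp : ∀ {x y} → x ≈ y → Kernel x → Kernel y
  Kernel-resp x≈y (kernel εx≈0) = kernel (F.trans (⟦⟧-cong (sym x≈y)) εx≈0)

  Kernel-+ : ∀ {x y} → Kernel x → Kernel y → Kernel (x + y)
  Kernel-+ (kernel εx≈0) (kernel εy≈0) =
    kernel (F.trans (+-homo _ _) (F.trans (F.+-cong εx≈0 εy≈0) (F.+-identityˡ F.0#)))

  I^1⇒Kernel : ∀ {x n} → x ∈I^ suc n → Kernel x
  I^1⇒Kernel (product kx h) = Kernel-* _ kx
  I^1⇒Kernel (plus h h′)    = Kernel-+ (I^1⇒Kernel h) (I^1⇒Kernel h′)
  I^1⇒Kernel (resp eq h)    = Kernel-resp eq (I^1⇒Kernel h)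

  I^-*ʳ : ∀ {n x} y → x ∈I^ n → (x * y) ∈I^ n
  I^-*ʳ y all            = all
  I^-*ʳ y (product kx h) = resp (sym (*-assoc _ _ y)) (product kx (I^-*ʳ y h))
  I^-*ʳ y (plus h h′)    = resp (sym (distribʳ y _ _)) (plus (I^-*ʳ y h) (I^-*ʳ y h′))
  I^-*ʳ y (resp eq h)    = resp (*-congʳ eq) (I^-*ʳ y h)

  I^-*ˡ : ∀ {n x} y → x ∈I^ n → (y * x) ∈I^ n
  I^-*ˡ y h = resp (*-comm _ y) (I^-*ʳ y h)

  I^-* : ∀ {m n x y} → x ∈I^ m → y ∈I^ n → (x * y) ∈I^ (m ℕ.+ n)
  I^-* {x = x} all h′    = I^-*ˡ x h′
  I^-* (product kx h) h′ = resp (sym (*-assoc _ _ _)) (product kx (I^-* h h′))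
  I^-* (plus h₁ h₂) h′   = resp (sym (distribʳ _ _ _)) (plus (I^-* h₁ h′) (I^-* h₂ h′))
  I^-* (resp eq h) h′    = resp (*-congʳ eq) (I^-* h h′)

  I^-pred : ∀ {n x} → x ∈I^ suc n → x ∈I^ n
  I^-pred (product kx h) = I^-*ˡ _ h
  I^-pred (plus h h′)    = plus (I^-pred h) (I^-pred h′)
  I^-pred (resp eq h)    = resp eq (I^-pred h)

  I^-≤ : ∀ {m n x} → m ≤ n → x ∈I^ n → x ∈I^ m
  I^-≤ {m} {zero}  z≤n  h = h
  I^-≤ {m} {suc n} m≤n h with ℕ.m≤n⇒m<n∨m≡n m≤n
  ... | inj₁ m<1+n      = I^-≤ (ℕ.s≤s⁻¹ m<1+n) (I^-pred h)
  ... | inj₂ ≡.refl     = h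

  Kernel⇒I^1 : ∀ {x} → Kernel x → x ∈I^ 1
  Kernel⇒I^1 {x} kx = resp (*-identityʳ x) (product kx all)

  I^-0# : ∀ n → 0# ∈I^ n
  I^-0# zero    = all
  I^-0# (suc n) = resp (zeroˡ 0#) (product (kernel 0#-homo) (I^-0# n))

  I^-neg : ∀ {n x} → x ∈I^ n → (- x) ∈I^ n
  I^-neg {x = x} h = resp (-1*x≈-x x) (I^-*ˡ (- 1#) h)

  I^-^ : ∀ {n x} k → x ∈I^ n → (x ^ k) ∈I^ (k ℕ.* n)
  I^-^ zero    h = all
  I^-^ (suc k) h = I^-* h (I^-^ k h)

  I^-sum : ∀ {n k} {t : Fin k → Carrier} → (∀ i → t i ∈I^ n) → sum t ∈I^ n
  I^-sum {n} {zero}  h = I^-0# n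
  I^-sum {n} {suc k} h = plus (h zero) (I^-sum (h ∘ suc))

  I^-cross : ∀ {n x} p .{{_ : NonZero p}} y → x ∈I^ n → cross p x y ∈I^ n
  I^-cross {x = x} p y h = I^-sum {t = crossTerm p x y} λ i →
    resp (sym (×-ι ((p C suc (toℕ i)) ℕ./ p) _)) (I^-*ˡ _ (I^-*ʳ _ (I^-*ʳ _ h)))

  module _ {p} (pr : Prime p) (p∈I : Kernel (ι p)) where

    private instance
      p-nonZero : NonZero p
      p-nonZero = prime⇒nonZero pr

    -- The gain of one power of `I` has two sources: `z ^ p` lies in `I ^ (2 * (n + 1))` as `p ≥ 2`,
    -- and the mixed terms contain, besides a factor `z`, the number `p`, which is itself in `I`.
    ^p-congruence : ∀ {n x y z} → z ∈I^ suc n → x ≈ z + y →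
                    ∃[ z′ ] z′ ∈I^ suc (suc n) ∧ x ^ p ≈ z′ + y ^ p
    ^p-congruence {n} {x} {y} {z} z∈ eq = z ^ p + ι p * cross p z y ,
      plus (I^-≤ bound (I^-^ p z∈)) (product p∈I (I^-cross p y z∈)) , (begin
        x ^ p                                  ≈⟨ ^-congˡ p eq ⟩
        (z + y) ^ p                            ≈⟨ frobenius pr z y ⟩
        z ^ p + y ^ p + ι p * cross p z y      ≈⟨ solve 3 (λ a b c → a :+ b :+ c := a :+ c :+ b) refl _ _ _ ⟩
        z ^ p + ι p * cross p z y + y ^ p      ∎)
      where
      bound : suc (suc n) ≤ p ℕ.* suc n
      bound = ℕ.≤-trans (s≤s (ℕ.≤-trans (ℕ.≤-reflexive (ℕ.+-comm 1 n)) (ℕ.+-monoʳ-≤ n (s≤s z≤n))))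
        (ℕ.*-monoˡ-≤ (suc n) (nonTrivial⇒n>1 p {{prime⇒nonTrivial pr}}))

    ^p^-congruence : ∀ {x y z} r → Kernel z → x ≈ z + y →
                     ∃[ z′ ] z′ ∈I^ suc r ∧ x ^ (p ℕ.^ r) ≈ z′ + y ^ (p ℕ.^ r)
    ^p^-congruence {x} {y} {z} zero kz eq = z , Kernel⇒I^1 kz ,
      trans (*-identityʳ x) (trans eq (+-congˡ (sym (*-identityʳ y))))
    ^p^-congruence {x} {y} (suc r) kz eq =
      let z′ , z′∈ , eq′  = ^p^-congruence r kz eq
          w  , w∈  , eq″ = ^p-congruence z′∈ eq′
      in w , w∈ , trans (^p^suc x) (trans eq″ (+-congˡ (sym (^p^suc y))))
      where
      ^p^suc : ∀ x → x ^ (p ℕ.^ suc r) ≈ (x ^ (p ℕ.^ r)) ^ p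
      ^p^suc x = trans (^-congʳ x (ℕ.*-comm p (p ℕ.^ r))) (sym (^-assocʳ x (p ℕ.^ r) p))

    -- If φ lifts the Frobenius then δ x = (φ x - x ^ p) / p maps I ^ (n + 1) to I ^ n.
    module _ {φ : Carrier → Carrier} (φ-homo : IsRingHomomorphism rawRing rawRing φ)
             (φ-kernel : ∀ {x} → Kernel x → Kernel (φ x))
             (φ-lift : ∀ x → ∃[ y ] φ x ≈ x ^ p + ι p * y) where

      private module φ = IsRingHomomorphism φ-homo

      δ-lowers : ∀ {n x} → x ∈I^ suc n → ∃[ y ] y ∈I^ n ∧ φ x ≈ x ^ p + ι p * y
      δ-lowers {zero}  {x} h = let y , eq = φ-lift x in y , all , eq
      δ-lowers {suc n} (product {x = x} {y = y} kx h) =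
        let x′ , eqx      = φ-lift x
            y′ , y′∈ , eqy = δ-lowers h
        -- The product rule δ(xy) = δ(x) y ^ p + φ(x) δ(y). In the first summand `y ^ p` supplies
        -- the membership; in the second `φ x` makes up for the power lost by `y′`.
        in x′ * y ^ p + φ x * y′ ,
           plus (I^-*ˡ x′ (I^-≤ (ℕ.m≤n*m (suc n) p) (I^-^ p h))) (product (φ-kernel kx) y′∈) , (begin
             φ (x * y)                                                ≈⟨ φ.*-homo x y ⟩
             φ x * φ y                                                ≈⟨ *-congˡ eqy ⟩
             φ x * (y ^ p + ι p * y′)                                 ≈⟨ distribˡ _ _ _ ⟩
             φ x * y ^ p + φ x * (ι p * y′)                           ≈⟨ +-congʳ (*-congʳ eqx) ⟩
             (x ^ p + ι p * x′) * y ^ p + φ x * (ι p * y′)            ≈⟨ solve 6 (λ a b c d e f → (a :+ b :* c) :* d :+ e :* (b :* f) := a :* d :+ b :* (c :* d :+ e :* f)) refl _ _ _ _ _ _ ⟩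
             x ^ p * y ^ p + ι p * (x′ * y ^ p + φ x * y′)            ≈⟨ +-congʳ (^-distrib-* x y p) ⟨
             (x * y) ^ p + ι p * (x′ * y ^ p + φ x * y′)              ∎)
      δ-lowers {suc n} (plus {x = x} {y = y} h h′) =
        let x′ , x′∈ , eqx = δ-lowers h
            y′ , y′∈ , eqy = δ-lowers h′
            c = cross p x y
        -- The sum rule δ(x + y) = δ(x) + δ(y) - `c`; the correction lies in the same power of `I`
        -- as `x`.
        in x′ + y′ + - c , plus (plus x′∈ y′∈) (I^-neg (I^-pred (I^-cross p y h))) , (begin
             φ (x + y)                                                  ≈⟨ φ.+-homo x y ⟩
             φ x + φ y                                                  ≈⟨ +-cong eqx eqy ⟩
             (x ^ p + ι p * x′) + (y ^ p + ι p * y′)                    ≈⟨ solve 5 (λ a b c d e → (a :+ b :* c) :+ (d :+ b :* e) := (a :+ d) :+ b :* (c :+ e)) refl _ _ _ _ _ ⟩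
             (x ^ p + y ^ p) + ι p * (x′ + y′)                          ≈⟨ +-congˡ (*-congˡ (trans (sym (+-identityʳ _)) (+-congˡ (sym (-‿inverseʳ c))))) ⟩
             (x ^ p + y ^ p) + ι p * (x′ + y′ + (c + - c))              ≈⟨ solve 6 (λ a b c d e f → (a :+ b) :+ c :* (d :+ (e :+ f)) := a :+ b :+ c :* e :+ c :* (d :+ f)) refl _ _ _ _ _ _ ⟩
             x ^ p + y ^ p + ι p * c + ι p * (x′ + y′ + - c)            ≈⟨ +-congʳ (frobenius pr x y) ⟨
             (x + y) ^ p + ι p * (x′ + y′ + - c)                        ∎)
      δ-lowers {suc n} (resp {x = x} {y = y} x≈y h) =
        let x′ , x′∈ , eqx = δ-lowers h
        in x′ , x′∈ , trans (φ.⟦⟧-cong (sym x≈y)) (trans eqx (+-congʳ (^-congˡ p x≈y)))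

-- The monoid ring ℤ[F], with F viewed as a multiplicative monoid.  Its elements
-- are ring expressions over generators [ a ]; two of them are equal when every
-- function F → ℤ, extended linearly, takes the same value on both.
module MonoidRing {c ℓ n} (F : FiniteField c ℓ n) where
  open FiniteField F using (commutativeRing; enumeration; _≈?_)
  private module F = CommutativeRing commutativeRing
  open F using (Carrier)

  infixl 6 _⊕_
  infixl 7 _⊛_
  infix  8 ⊖_

  data Expr : Set c where
    gen     : Carrier → Expr
    𝟘       : Expr
    _⊕_ _⊛_ : Expr → Expr → Expr
    ⊖_      : Expr → Expr

  -- Reads an expression as a signed measure on the field and integrates `f` against it. Then `⊛` is
  -- convolution along the multiplication, and its commutativity is the exchange of two integrals.
  ⟨_,_⟩ : Expr → (Carrier → ℤ) → ℤ
  ⟨ gen a , f ⟩ = f a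
  ⟨ 𝟘     , f ⟩ = 0ℤ
  ⟨ x ⊕ y , f ⟩ = ⟨ x , f ⟩ ℤ.+ ⟨ y , f ⟩
  ⟨ x ⊛ y , f ⟩ = ⟨ x , (λ a → ⟨ y , (λ b → f (a F.* b)) ⟩) ⟩
  ⟨ ⊖ x   , f ⟩ = ℤ.- ⟨ x , f ⟩

  Respects : (Carrier → ℤ) → Set (c ⊔ ℓ)
  Respects f = ∀ {a b} → a F.≈ b → f a ≡ f b

  infix 4 _≋_
  record _≋_ (x y : Expr) : Set (c ⊔ ℓ) where
    constructor equal
    field on : ∀ f → Respects f → ⟨ x , f ⟩ ≡ ⟨ y , f ⟩
  open _≋_

  ext : ∀ x {f g} → (∀ a → f a ≡ g a) → ⟨ x , f ⟩ ≡ ⟨ x , g ⟩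
  ext (gen a) f≗g = f≗g a
  ext 𝟘       f≗g = ≡.refl
  ext (x ⊕ y) f≗g = ≡.cong₂ ℤ._+_ (ext x f≗g) (ext y f≗g)
  ext (x ⊛ y) f≗g = ext x λ a → ext y λ b → f≗g (a F.* b)
  ext (⊖ x)   f≗g = ≡.cong ℤ.-_ (ext x f≗g)

  ⟨,⟩-+ : ∀ x f g → ⟨ x , (λ a → f a ℤ.+ g a) ⟩ ≡ ⟨ x , f ⟩ ℤ.+ ⟨ x , g ⟩
  ⟨,⟩-+ (gen a) f g = ≡.refl
  ⟨,⟩-+ 𝟘       f g = ≡.refl
  ⟨,⟩-+ (x ⊕ y) f g = ≡.trans (≡.cong₂ ℤ._+_ (⟨,⟩-+ x f g) (⟨,⟩-+ y f g))
    (solve 4 (λ a b c d → (a :+ b) :+ (c :+ d) := (a :+ c) :+ (b :+ d)) ≡.refl (⟨ x , f ⟩) (⟨ x , g ⟩) (⟨ y , f ⟩) (⟨ y , g ⟩))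
    where open Data.Integer.Solver.+-*-Solver
  ⟨,⟩-+ (x ⊛ y) f g = ≡.trans (ext x λ a → ⟨,⟩-+ y _ _) (⟨,⟩-+ x _ _)
  ⟨,⟩-+ (⊖ x)   f g = ≡.trans (≡.cong ℤ.-_ (⟨,⟩-+ x f g)) (ℤ.neg-distrib-+ (⟨ x , f ⟩) _)

  ⟨,⟩-0 : ∀ x → ⟨ x , (λ _ → 0ℤ) ⟩ ≡ 0ℤ
  ⟨,⟩-0 (gen a) = ≡.refl
  ⟨,⟩-0 𝟘       = ≡.refl
  ⟨,⟩-0 (x ⊕ y) = ≡.cong₂ ℤ._+_ (⟨,⟩-0 x) (⟨,⟩-0 y)
  ⟨,⟩-0 (x ⊛ y) = ≡.trans (ext x λ _ → ⟨,⟩-0 y) (⟨,⟩-0 x)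
  ⟨,⟩-0 (⊖ x)   = ≡.cong ℤ.-_ (⟨,⟩-0 x)

  ⟨,⟩-neg : ∀ x f → ⟨ x , (λ a → ℤ.- f a) ⟩ ≡ ℤ.- ⟨ x , f ⟩
  ⟨,⟩-neg (gen a) f = ≡.refl
  ⟨,⟩-neg 𝟘       f = ≡.refl
  ⟨,⟩-neg (x ⊕ y) f = ≡.trans (≡.cong₂ ℤ._+_ (⟨,⟩-neg x f) (⟨,⟩-neg y f)) (≡.sym (ℤ.neg-distrib-+ (⟨ x , f ⟩) _))
  ⟨,⟩-neg (x ⊛ y) f = ≡.trans (ext x λ a → ⟨,⟩-neg y _) (⟨,⟩-neg x _)
  ⟨,⟩-neg (⊖ x)   f = ≡.cong ℤ.-_ (⟨,⟩-neg x f)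

  fubini : ∀ x y (f : Carrier → Carrier → ℤ) →
           ⟨ x , (λ a → ⟨ y , f a ⟩) ⟩ ≡ ⟨ y , (λ b → ⟨ x , (λ a → f a b) ⟩) ⟩
  fubini (gen a)  y f = ≡.refl
  fubini 𝟘        y f = ≡.sym (⟨,⟩-0 y)
  fubini (x ⊕ x′) y f = ≡.trans (≡.cong₂ ℤ._+_ (fubini x y f) (fubini x′ y f)) (≡.sym (⟨,⟩-+ y _ _))
  fubini (x ⊛ x′) y f = ≡.trans (ext x λ a → fubini x′ y _) (fubini x y _)
  fubini (⊖ x)    y f = ≡.trans (≡.cong ℤ.-_ (fubini x y f)) (≡.sym (⟨,⟩-neg y _))

  translate : ∀ {f} → Respects f → ∀ a → Respects (λ b → f (a F.* b))
  translate f-resp a b≈b′ = f-resp (F.*-congˡ b≈b′)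

  partial : ∀ {f} y → Respects f → Respects (λ a → ⟨ y , (λ b → f (a F.* b)) ⟩)
  partial y f-resp a≈a′ = ext y λ b → f-resp (F.*-congʳ a≈a′)

  ring : CommutativeRing c (c ⊔ ℓ)
  ring = record
    { Carrier = Expr
    ; _≈_ = _≋_ ; _+_ = _⊕_ ; _*_ = _⊛_ ; -_ = ⊖_ ; 0# = 𝟘 ; 1# = gen F.1#
    ; isCommutativeRing = record
      { isRing = record
        { +-isAbelianGroup = record
          { isGroup = record
            { isMonoid = record
              { isSemigroup = record
                { isMagma = record
                  { isEquivalence = record
                    { refl  = equal λ _ _ → ≡.refl
                    ; sym   = λ e → equal λ f r → ≡.sym (on e f r)
                    ; trans = λ e e′ → equal λ f r → ≡.trans (on e f r) (on e′ f r) }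
                  ; ∙-cong = λ e e′ → equal λ f r → ≡.cong₂ ℤ._+_ (on e f r) (on e′ f r) }
                ; assoc = λ x y z → equal λ f _ → ℤ.+-assoc (⟨ x , f ⟩) (⟨ y , f ⟩) (⟨ z , f ⟩) }
              ; identity = (λ x → equal λ f _ → ℤ.+-identityˡ (⟨ x , f ⟩)) , (λ x → equal λ f _ → ℤ.+-identityʳ (⟨ x , f ⟩)) }
            ; inverse = (λ x → equal λ f _ → ℤ.+-inverseˡ (⟨ x , f ⟩)) , (λ x → equal λ f _ → ℤ.+-inverseʳ (⟨ x , f ⟩))
            ; ⁻¹-cong = λ e → equal λ f r → ≡.cong ℤ.-_ (on e f r) }
          ; comm = λ x y → equal λ f _ → ℤ.+-comm (⟨ x , f ⟩) (⟨ y , f ⟩) }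
        ; *-cong = λ {x} {x′} {y} {y′} e e′ → equal λ f r →
            ≡.trans (ext x λ a → on e′ _ (translate r a)) (on e _ (partial y′ r))
        ; *-assoc = λ x y z → equal λ f r → ext x λ a → ext y λ b → ext z λ c → r (F.*-assoc a b c)
        ; *-identity = (λ x → equal λ f r → ext x λ a → r (F.*-identityˡ a))
                     , (λ x → equal λ f r → ext x λ a → r (F.*-identityʳ a))
        ; distrib = (λ x y z → equal λ f _ → ⟨,⟩-+ x _ _) , (λ x y z → equal λ f _ → ≡.refl) }
      ; *-comm = λ x y → equal λ f r → ≡.trans (fubini x y _) (ext y λ b → ext x λ a → r (F.*-comm a b)) } }

  open CommutativeRing ring public
    using (_≈_; refl; sym; trans; setoid; _+_; _*_; -_; 0#; 1#; rawRing; semiring; commutativeSemiring; +-commutativeMonoid; *-commutativeMonoid)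
  module R = CommutativeRing ring
  open Frobenius ring using (ι; ι-*; ι-^; 0#^; frobenius; cross; ×-ι)
  open Algebra.Properties.CommutativeSemiring.Exp commutativeSemiring public
  open Algebra.Properties.Semiring.Mult semiring using (_×_; ×-homo-+)
  private
    module F^ = Algebra.Properties.CommutativeSemiring.Exp F.commutativeSemiring
    module F× = Algebra.Properties.Semiring.Mult F.semiring
    module FΣ = Algebra.Properties.Semiring.Sum F.semiring

  gen-cong : ∀ {a b} → a F.≈ b → gen a ≈ gen b
  gen-cong a≈b = equal λ f r → r a≈b

  gen-* : ∀ a b → gen (a F.* b) ≈ gen a * gen b
  gen-* a b = equal λ _ _ → ≡.refl

  gen-^ : ∀ a k → gen (a F^.^ k) ≈ gen a ^ k
  gen-^ a zero    = refl
  gen-^ a (suc k) = trans (gen-* a _) (R.*-congˡ {gen a} (gen-^ a k))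

  ε : Expr → Carrier
  ε (gen a) = a
  ε 𝟘       = F.0#
  ε (x ⊕ y) = ε x F.+ ε y
  ε (x ⊛ y) = ε x F.* ε y
  ε (⊖ x)   = F.- ε x

  fromℤ : ℤ → Carrier → Carrier
  fromℤ (ℤ.+ k)      b = k F×.× b
  fromℤ ℤ.-[1+ k ] b = F.- (suc k F×.× b)

  private
    module Z = Relation.Binary.Reasoning.Setoid F.setoid
    open Algebra.Properties.Ring F.ring using (-‿distribˡ-*; -0#≈0#; -‿+-comm)
    open Algebra.Properties.Group F.+-group using (⁻¹-involutive)

  fromℤ-neg : ∀ i b → fromℤ (ℤ.- i) b F.≈ F.- fromℤ i b
  fromℤ-neg (ℤ.+ zero)     b = F.sym -0#≈0#
  fromℤ-neg (ℤ.+ suc k)    b = F.refl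
  fromℤ-neg ℤ.-[1+ k ]   b = F.sym (⁻¹-involutive _)

  fromℤ-⊖ : ∀ k l b → fromℤ (k ℤ.⊖ l) b F.≈ k F×.× b F.+ F.- (l F×.× b)
  fromℤ-⊖ k zero b = Z.begin
    k F×.× b                Z.≈⟨ F.+-identityʳ _ ⟨
    k F×.× b F.+ F.0#       Z.≈⟨ F.+-congˡ -0#≈0# ⟨
    k F×.× b F.+ F.- F.0#   Z.∎
  fromℤ-⊖ zero    (suc l) b = F.sym (F.+-identityˡ _)
  fromℤ-⊖ (suc k) (suc l) b = Z.begin
    fromℤ (suc k ℤ.⊖ suc l) b                        Z.≡⟨ ≡.cong (λ i → fromℤ i b) (ℤ.[1+m]⊖[1+n]≡m⊖n k l) ⟩
    fromℤ (k ℤ.⊖ l) b                                Z.≈⟨ fromℤ-⊖ k l b ⟩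
    K F.+ F.- L                                      Z.≈⟨ F.+-congʳ (F.+-identityʳ K) ⟨
    K F.+ F.0# F.+ F.- L                             Z.≈⟨ F.+-congʳ (F.+-congˡ (F.-‿inverseʳ b)) ⟨
    K F.+ (b F.+ F.- b) F.+ F.- L                    Z.≈⟨ solve 4 (λ b b′ k l → k :+ (b :+ b′) :+ l := b :+ k :+ (b′ :+ l)) F.refl b (F.- b) K (F.- L) ⟩
    b F.+ K F.+ (F.- b F.+ F.- L)                    Z.≈⟨ F.+-congˡ (-‿+-comm b L) ⟩
    suc k F×.× b F.+ F.- (suc l F×.× b)              Z.∎
    where
    open Algebra.Solver.Ring.NaturalCoefficients.Default F.commutativeSemiring using (solve; _:+_; _:=_)
    K = k F×.× b
    L = l F×.× b

  fromℤ-+ : ∀ i j b → fromℤ (i ℤ.+ j) b F.≈ fromℤ i b F.+ fromℤ j b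
  fromℤ-+ (ℤ.+ k)      (ℤ.+ l)      b = F×.×-homo-+ b k l
  fromℤ-+ (ℤ.+ k)      ℤ.-[1+ l ] b = fromℤ-⊖ k (suc l) b
  fromℤ-+ ℤ.-[1+ k ] (ℤ.+ l)      b = F.trans (fromℤ-⊖ l (suc k) b) (F.+-comm _ _)
  fromℤ-+ ℤ.-[1+ k ] ℤ.-[1+ l ] b = Z.begin
    F.- (suc (suc (k ℕ.+ l)) F×.× b)                 Z.≡⟨ ≡.cong (λ m → F.- (suc m F×.× b)) (≡.sym (ℕ.+-suc k l)) ⟩
    F.- ((suc k ℕ.+ suc l) F×.× b)                   Z.≈⟨ F.-‿cong (F×.×-homo-+ b (suc k) (suc l)) ⟩
    F.- (suc k F×.× b F.+ suc l F×.× b)              Z.≈⟨ -‿+-comm _ _ ⟨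
    F.- (suc k F×.× b) F.+ F.- (suc l F×.× b)        Z.∎

  private
    elt : Fin n → Carrier
    elt = Inverse.from enumeration

    neg-sum : ∀ {k} (t : Fin k → Carrier) → F.- FΣ.sum t F.≈ FΣ.sum (λ i → F.- t i)
    neg-sum {zero}  t = -0#≈0#
    neg-sum {suc k} t = F.trans (F.sym (-‿+-comm _ _)) (F.+-congˡ (neg-sum (t ∘ suc)))

    zero-sum : ∀ k → FΣ.sum {k} (λ _ → F.0#) F.≈ F.0#
    zero-sum k = FΣ.sum-replicate-zero k

    -- The relation a ↦ Σᵢ fᵢ(a) bᵢ = a · d persists after linear extension
    -- to ℤ[F]; applied to the indicators fᵢ of the elements bᵢ it expresses ε
    -- through functions F → ℤ.
    combination : ∀ {k} (b : Fin k → Carrier) x (f : Fin k → Carrier → ℤ) d →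
      (∀ a → FΣ.sum (λ i → fromℤ (f i a) (b i)) F.≈ a F.* d) →
      FΣ.sum (λ i → fromℤ (⟨ x , f i ⟩) (b i)) F.≈ ε x F.* d
    combination b (gen a) f d eq = eq a
    combination {k} b 𝟘       f d eq = F.trans (zero-sum k) (F.sym (F.zeroˡ d))
    combination b (x ⊕ y) f d eq = Z.begin
      FΣ.sum (λ i → fromℤ (⟨ x , f i ⟩ ℤ.+ ⟨ y , f i ⟩) (b i))
        Z.≈⟨ FΣ.sum-cong-≋ (λ i → fromℤ-+ (⟨ x , f i ⟩) _ (b i)) ⟩
      FΣ.sum (λ i → fromℤ (⟨ x , f i ⟩) (b i) F.+ fromℤ (⟨ y , f i ⟩) (b i))
        Z.≈⟨ FΣ.∑-distrib-+ (λ i → fromℤ (⟨ x , f i ⟩) (b i)) _ ⟩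
      FΣ.sum (λ i → fromℤ (⟨ x , f i ⟩) (b i)) F.+ FΣ.sum (λ i → fromℤ (⟨ y , f i ⟩) (b i))
        Z.≈⟨ F.+-cong (combination b x f d eq) (combination b y f d eq) ⟩
      ε x F.* d F.+ ε y F.* d
        Z.≈⟨ F.distribʳ d (ε x) (ε y) ⟨
      (ε x F.+ ε y) F.* d Z.∎
    -- This case forces `d` to be general: for fixed `a` the hypothesis for `y` is used with
    -- `a F.* d`, and the one for `x` with `ε y F.* d`.
    combination b (x ⊛ y) f d eq = F.trans
      (combination b x _ (ε y F.* d) λ a → F.trans
        (combination b y (λ i b → f i (a F.* b)) (a F.* d) λ b → F.trans (eq (a F.* b))
          (solve 3 (λ a b d → a :* b :* d := b :* (a :* d)) F.refl a b d))
        (solve 3 (λ a y d → y :* (a :* d) := a :* (y :* d)) F.refl a (ε y) d))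
      (F.sym (F.*-assoc _ _ _))
      where open Algebra.Solver.Ring.NaturalCoefficients.Default F.commutativeSemiring using (solve; _:*_; _:=_)
    combination b (⊖ x) f d eq = Z.begin
      FΣ.sum (λ i → fromℤ (ℤ.- ⟨ x , f i ⟩) (b i))      Z.≈⟨ FΣ.sum-cong-≋ (λ i → fromℤ-neg (⟨ x , f i ⟩) (b i)) ⟩
      FΣ.sum (λ i → F.- fromℤ (⟨ x , f i ⟩) (b i))      Z.≈⟨ neg-sum (λ i → fromℤ (⟨ x , f i ⟩) (b i)) ⟨
      F.- FΣ.sum (λ i → fromℤ (⟨ x , f i ⟩) (b i))      Z.≈⟨ F.-‿cong (combination b x f d eq) ⟩
      F.- (ε x F.* d)                                   Z.≈⟨ -‿distribˡ-* (ε x) d ⟩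
      (F.- ε x) F.* d                                   Z.∎

    indicator : Fin n → Carrier → ℤ
    indicator i a = if does (i Fin.≟ Inverse.to enumeration a) then 1ℤ else 0ℤ

    indicator-respects : ∀ i → Respects (indicator i)
    indicator-respects i a≈b = ≡.cong (λ j → if does (i Fin.≟ j) then 1ℤ else 0ℤ) (Inverse.to-cong enumeration a≈b)

    sum-indicator : ∀ {k} (b : Fin k → Carrier) j →
      FΣ.sum (λ i → fromℤ (if does (i Fin.≟ j) then 1ℤ else 0ℤ) (b i)) F.≈ b j
    sum-indicator {suc k} b zero    = F.trans (F.+-cong (F×.×-homo-1 (b zero)) (zero-sum k)) (F.+-identityʳ _)
    sum-indicator b (suc j) = F.trans (F.+-identityˡ _) (sum-indicator (b ∘ suc) j)

    ε-indicator : ∀ x → FΣ.sum (λ i → fromℤ (⟨ x , indicator i ⟩) (elt i)) F.≈ ε x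
    ε-indicator x = F.trans (combination elt x indicator F.1# λ a →
        F.trans (sum-indicator elt (Inverse.to enumeration a))
        (F.trans (Inverse.strictlyInverseʳ enumeration a) (F.sym (F.*-identityʳ a))))
      (F.*-identityʳ (ε x))

  ε-cong : ∀ {x y} → x ≈ y → ε x F.≈ ε y
  ε-cong {x} {y} x≈y = F.trans (F.sym (ε-indicator x)) (F.trans
    (FΣ.sum-cong-≋ λ i → F.reflexive (≡.cong (λ k → fromℤ k (elt i)) (on x≈y (indicator i) (indicator-respects i))))
    (ε-indicator y))

  ε-homo : IsRingHomomorphism rawRing F.rawRing ε
  ε-homo = record
    { isSemiringHomomorphism = record
      { isNearSemiringHomomorphism = record
        { +-isMonoidHomomorphism = record
          { isMagmaHomomorphism = record
            { isRelHomomorphism = record { cong = ε-cong }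
            ; homo = λ _ _ → F.refl }
          ; ε-homo = F.refl }
        ; *-homo = λ _ _ → F.refl }
      ; 1#-homo = F.refl }
    ; -‿homo = λ _ → F.refl }

  ε-ι : ∀ k → ε (ι k) ≡ k F×.× F.1#
  ε-ι zero    = ≡.refl
  ε-ι (suc k) = ≡.cong (F.1# F.+_) (ε-ι k)

  ⟨ι*,⟩ : ∀ k x {f} → Respects f → ⟨ ι k * x , f ⟩ ≡ (ℤ.+ k) ℤ.* ⟨ x , f ⟩
  ⟨ι*,⟩ zero    x {f} r = ≡.sym (ℤ.*-zeroˡ (⟨ x , f ⟩))
  ⟨ι*,⟩ (suc k) x {f} r = ≡.trans
    (≡.cong₂ ℤ._+_ (ext x λ b → r (F.*-identityˡ b)) (⟨ι*,⟩ k x r))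
    (≡.sym (ℤ.suc-* (ℤ.+ k) (⟨ x , f ⟩)))

  -- Torsion-freeness comes from the test functions taking values in ℤ. It determines δ at an
  -- integer.
  ι-cancel : ∀ k .{{_ : NonZero k}} {x y} → ι k * x ≈ ι k * y → x ≈ y
  ι-cancel k {x} {y} eq = equal λ f r → ℤ.*-cancelˡ-≡ (ℤ.+ k) (⟨ x , f ⟩) (⟨ y , f ⟩)
    (≡.trans (≡.sym (⟨ι*,⟩ k x r)) (≡.trans (on eq f r) (⟨ι*,⟩ k y r)))

  -- The lift of Frobenius, and integers in powers of I.

  module _ (p : ℕ) where

    φ : Expr → Expr
    φ (gen a) = gen (a F^.^ p)
    φ 𝟘       = 𝟘
    φ (x ⊕ y) = φ x ⊕ φ y
    φ (x ⊛ y) = φ x ⊛ φ y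
    φ (⊖ x)   = ⊖ φ x

    ⟨φ,⟩ : ∀ x {f} → Respects f → ⟨ φ x , f ⟩ ≡ ⟨ x , (λ a → f (a F^.^ p)) ⟩
    ⟨φ,⟩ (gen a) r = ≡.refl
    ⟨φ,⟩ 𝟘       r = ≡.refl
    ⟨φ,⟩ (x ⊕ y) r = ≡.cong₂ ℤ._+_ (⟨φ,⟩ x r) (⟨φ,⟩ y r)
    ⟨φ,⟩ (x ⊛ y) r = ≡.trans (⟨φ,⟩ x (partial (φ y) r)) (ext x λ a →
      ≡.trans (⟨φ,⟩ y (translate r _)) (ext y λ b → r (F.sym (F^.^-distrib-* a b p))))
    ⟨φ,⟩ (⊖ x)   r = ≡.cong ℤ.-_ (⟨φ,⟩ x r)

    φ-homo : IsRingHomomorphism rawRing rawRing φ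
    φ-homo = record
      { isSemiringHomomorphism = record
        { isNearSemiringHomomorphism = record
          { +-isMonoidHomomorphism = record
            { isMagmaHomomorphism = record
              { isRelHomomorphism = record { cong = λ {x} {y} e → equal λ f r →
                  ≡.trans (⟨φ,⟩ x r) (≡.trans (on e _ (λ a≈b → r (F^.^-congˡ p a≈b))) (≡.sym (⟨φ,⟩ y r))) }
              ; homo = λ _ _ → refl }
            ; ε-homo = refl }
          ; *-homo = λ _ _ → refl }
        ; 1#-homo = gen-cong (Frobenius.1#^ commutativeRing p) }
      ; -‿homo = λ _ → refl }
    φ-ι : ∀ k → φ (ι k) ≈ ι k
    φ-ι zero    = refl
    φ-ι (suc k) = R.+-cong (IsRingHomomorphism.1#-homo φ-homo) (φ-ι k)

  module _ {p} (pr : Prime p) (char : p F×.× F.1# F.≈ F.0#) where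
    open IdealPowers ring commutativeRing ε-homo

    private
      instance
        p-nonZero : NonZero p
        p-nonZero = prime⇒nonZero pr

      p∈I : Kernel (ι p)
      p∈I = kernel (F.trans (F.reflexive (ε-ι p)) char)

    open Relation.Binary.Reasoning.Setoid setoid
    open Algebra.Solver.Ring.NaturalCoefficients.Default commutativeSemiring using (solve; _:+_; _:*_; _:=_)

    -- On a generator `φ` is exactly the p-th power; the remaining cases are the sum, product and
    -- sign rules for δ.
    φ-lift : ∀ x → ∃[ y ] φ p x ≈ x ^ p + ι p * y
    φ-lift (gen a) = 0# , trans (gen-^ a p) (sym (trans (R.+-congˡ (R.zeroʳ (ι p))) (R.+-identityʳ _)))
    φ-lift 𝟘       = 0# , sym (trans (R.+-cong (0#^ p) (R.zeroʳ (ι p))) (R.+-identityʳ 0#))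
    φ-lift (x ⊕ y) = let x′ , eqx = φ-lift x ; y′ , eqy = φ-lift y ; c = cross p x y in
      x′ + y′ + - c , (begin
        φ p x + φ p y                                         ≈⟨ R.+-cong eqx eqy ⟩
        (x ^ p + ι p * x′) + (y ^ p + ι p * y′)               ≈⟨ R.+-identityʳ _ ⟨
        (x ^ p + ι p * x′) + (y ^ p + ι p * y′) + 0#          ≈⟨ R.+-congˡ (trans (R.*-congˡ (R.-‿inverseʳ c)) (R.zeroʳ (ι p))) ⟨
        (x ^ p + ι p * x′) + (y ^ p + ι p * y′) + ι p * (c + - c)
          ≈⟨ solve 7 (λ a b c d e f g → (a :+ b :* c) :+ (d :+ b :* e) :+ b :* (f :+ g) := a :+ d :+ b :* f :+ b :* (c :+ e :+ g)) refl (x ^ p) (ι p) x′ (y ^ p) y′ c (- c) ⟩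
        x ^ p + y ^ p + ι p * c + ι p * (x′ + y′ + - c)       ≈⟨ R.+-congʳ (frobenius pr x y) ⟨
        (x + y) ^ p + ι p * (x′ + y′ + - c)                   ∎)
    φ-lift (x ⊛ y) = let x′ , eqx = φ-lift x ; y′ , eqy = φ-lift y in
      x′ * y ^ p + φ p x * y′ , (begin
        φ p x * φ p y                                      ≈⟨ R.*-congˡ {φ p x} eqy ⟩
        φ p x * (y ^ p + ι p * y′)                         ≈⟨ R.distribˡ (φ p x) _ _ ⟩
        φ p x * y ^ p + φ p x * (ι p * y′)                 ≈⟨ R.+-congʳ (R.*-congʳ eqx) ⟩
        (x ^ p + ι p * x′) * y ^ p + φ p x * (ι p * y′)    ≈⟨ solve 6 (λ a b c d e f → (a :+ b :* c) :* d :+ e :* (b :* f) := a :* d :+ b :* (c :* d :+ e :* f)) refl (x ^ p) (ι p) x′ (y ^ p) (φ p x) y′ ⟩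
        x ^ p * y ^ p + ι p * (x′ * y ^ p + φ p x * y′)    ≈⟨ R.+-congʳ (^-distrib-* x y p) ⟨
        (x * y) ^ p + ι p * (x′ * y ^ p + φ p x * y′)      ∎)
    -- For p = 2 a sign does not pass through the p-th power, so `- (x ^ p)` is obtained by
    -- expanding `(x + - x) ^ p`, which is 0.
    φ-lift (⊖ x) = let x′ , eqx = φ-lift x ; c = cross p x (- x) in
      c + - x′ , (begin
        - φ p x                                               ≈⟨ R.+-identityʳ _ ⟨
        - φ p x + 0#                                          ≈⟨ R.+-congˡ zero-expansion ⟨
        - φ p x + (x ^ p + (- x) ^ p + ι p * c)               ≈⟨ R.+-congʳ (trans (R.-‿cong eqx) (trans (sym (R-‿+-comm _ _)) (R.+-congˡ (-‿distribʳ-* (ι p) x′)))) ⟩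
        - (x ^ p) + ι p * (- x′) + (x ^ p + (- x) ^ p + ι p * c)
          ≈⟨ solve 6 (λ a a′ b x′ c d → a′ :+ b :* x′ :+ (a :+ d :+ b :* c) := (a′ :+ a) :+ (d :+ b :* (c :+ x′))) refl (x ^ p) (- (x ^ p)) (ι p) (- x′) c ((- x) ^ p) ⟩
        - (x ^ p) + x ^ p + ((- x) ^ p + ι p * (c + - x′))    ≈⟨ trans (R.+-congʳ (R.-‿inverseˡ (x ^ p))) (R.+-identityˡ _) ⟩
        (- x) ^ p + ι p * (c + - x′)                          ∎)
      where
      open Algebra.Properties.Ring R.ring using (-‿distribʳ-*) renaming (-‿+-comm to R-‿+-comm)
      zero-expansion : x ^ p + (- x) ^ p + ι p * cross p x (- x) ≈ 0#
      zero-expansion = trans (sym (frobenius pr x (- x))) (trans (^-congˡ p (R.-‿inverseʳ x)) (0#^ p))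

    φ-kernel : ∀ {x} → Kernel x → Kernel (φ p x)
    φ-kernel {x} kx = let y , eq = φ-lift x in
      Kernel-resp (sym eq) (Kernel-+ (Kernel-resp (^-congʳ x (ℕ.suc-pred p)) (Kernel-* (x ^ pred p) kx)) (Kernel-* y p∈I))

    δ-I^ : ∀ {n x} → x ∈I^ suc n → ∃[ y ] y ∈I^ n ∧ φ p x ≈ x ^ p + ι p * y
    δ-I^ = δ-lowers pr p∈I (φ-homo p) φ-kernel φ-lift

    -- Otherwise `p` and `k` would be coprime, and a Bézout relation between them would give 1 = 0
    -- in the field.
    Kernel-ι⇒∣ : ∀ k → Kernel (ι k) → p ∣ k
    Kernel-ι⇒∣ k (kernel kι) with p ∣? k
    ... | yes p∣k = p∣k
    ... | no  p∤k = contradiction 0≈1 (FiniteField.0≉1 F)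
      where
      coprime : ∀ {d} → d ∣ p ∧ d ∣ k → d ≡ 1
      coprime (d∣p , d∣k) with prime⇒irreducible pr d∣p
      ... | inj₁ d≡1    = d≡1
      ... | inj₂ ≡.refl = contradiction d∣k p∤k
      multiple≈0 : ∀ x {l} → l F×.× F.1# F.≈ F.0# → (x ℕ.* l) F×.× F.1# F.≈ F.0#
      multiple≈0 x {l} l≈0 = F.trans (F.sym (F×.×-assocˡ F.1# x l)) (F.trans (F×.×-congʳ x l≈0)
        (F.trans (Frobenius.×-ι commutativeRing x F.0#) (F.zeroʳ _)))
      k≈0 : k F×.× F.1# F.≈ F.0#
      k≈0 = F.trans (F.reflexive (≡.sym (ε-ι k))) kι
      one≈0 : ∀ x y {l l′} → l F×.× F.1# F.≈ F.0# → l′ F×.× F.1# F.≈ F.0# →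
              1 ℕ.+ y ℕ.* l ≡ x ℕ.* l′ → F.0# F.≈ F.1#
      one≈0 x y {l} {l′} l≈0 l′≈0 eq = F.sym (Z.begin
        F.1#                                    Z.≈⟨ F.+-identityʳ F.1# ⟨
        F.1# F.+ F.0#                           Z.≈⟨ F.+-congˡ (multiple≈0 y l≈0) ⟨
        (1 ℕ.+ y ℕ.* l) F×.× F.1#               Z.≡⟨ ≡.cong (F×._× F.1#) eq ⟩
        (x ℕ.* l′) F×.× F.1#                    Z.≈⟨ multiple≈0 x l′≈0 ⟩
        F.0#                                    Z.∎)
      0≈1 : F.0# F.≈ F.1#
      0≈1 with coprime-Bézout {p} {k} coprime
      ... | Bézout.+- x y eq = one≈0 x y k≈0 char eq
      ... | Bézout.-+ x y eq = one≈0 y x char k≈0 eq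

    -- Since `φ` fixes integers, δ at `k` is (k - k ^ p) / p. For k = k′ p this is - k′ w, where w =
    -- k ^ (p - 1) - 1 is prime to `p`. The induction hypothesis for `k′ * w` therefore yields
    -- `p ^ K ∣ k′`.
    I^-ι⇒∣ : ∀ K k → ι k ∈I^ K → p ℕ.^ K ∣ k
    I^-ι⇒∣ zero    k       _ = 1∣ k
    I^-ι⇒∣ (suc K) zero    _ = _ ∣0
    I^-ι⇒∣ (suc K) k@(suc _) h with Kernel-ι⇒∣ k (I^1⇒Kernel h) | δ-I^ h
    ... | p∣k@(divides k′ k≡k′p) | y , y∈ , eq =
      ≡.subst (p ℕ.^ suc K ∣_) (≡.trans (ℕ.*-comm p k′) (≡.sym k≡k′p))
        (*-monoʳ-∣ p (cancel-w K k′ (I^-ι⇒∣ K (k′ ℕ.* w) (resp -y≈ (I^-neg y∈)))))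
      where
      open Algebra.Properties.Ring R.ring using (-‿distribʳ-*) renaming (-‿+-comm to R-‿+-comm)
      w = pred (k ℕ.^ pred p)
      instance
        k^≢0 : NonZero (k ℕ.^ pred p)
        k^≢0 = ℕ.m^n≢0 k (pred p)
      k^p : k ℕ.^ p ≡ k ℕ.+ k ℕ.* w
      k^p = ≡.trans (≡.cong (k ℕ.^_) (≡.sym (ℕ.suc-pred p)))
        (≡.trans (≡.cong (k ℕ.*_) (≡.sym (ℕ.suc-pred (k ℕ.^ pred p)))) (ℕ.*-suc k w))
      p∤w : ¬ p ∣ w
      p∤w p∣w = ℕ.<⇒≢ (nonTrivial⇒n>1 p {{prime⇒nonTrivial pr}}) (≡.sym (∣1⇒≡1 (∣m+n∣m⇒∣n
        (≡.subst (p ∣_) (≡.trans (≡.sym (ℕ.suc-pred (k ℕ.^ pred p))) (ℕ.+-comm 1 w)) p∣k^) p∣w)))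
        where
        p∣k^ : p ∣ k ℕ.^ pred p
        p∣k^ = ≡.subst (λ j → p ∣ k ℕ.^ j) (ℕ.suc-pred (pred p) {{ℕ.>-nonZero (ℕ.pred-mono-≤ (nonTrivial⇒n>1 p {{prime⇒nonTrivial pr}}))}})
          (∣m⇒∣m*n _ p∣k)
      cancel-w : ∀ K a → p ℕ.^ K ∣ a ℕ.* w → p ℕ.^ K ∣ a
      cancel-w zero    a _ = 1∣ a
      cancel-w (suc K) a d with euclidsLemma a w pr (∣-trans (m∣m*n (p ℕ.^ K)) d)
      ... | inj₂ p∣w = contradiction p∣w p∤w
      ... | inj₁ (divides a′ ≡.refl) = ≡.subst (p ℕ.^ suc K ∣_) (ℕ.*-comm p a′) (*-monoʳ-∣ p
        (cancel-w K a′ (*-cancelˡ-∣ p (≡.subst (p ℕ.^ suc K ∣_) (≡.trans (≡.cong (ℕ._* w) (ℕ.*-comm a′ p)) (ℕ.*-assoc p a′ w)) d))))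
      -y≈ : - y ≈ ι (k′ ℕ.* w)
      -y≈ = ι-cancel p (begin
        ι p * (- y)                                     ≈⟨ -‿distribʳ-* (ι p) y ⟨
        - (ι p * y)                                     ≈⟨ R.+-identityˡ _ ⟨
        0# + - (ι p * y)                                ≈⟨ R.+-congʳ vanish ⟨
        ι (k ℕ.* w) + ι p * y + - (ι p * y)             ≈⟨ trans (R.+-assoc _ _ _) (trans (R.+-congˡ (R.-‿inverseʳ _)) (R.+-identityʳ _)) ⟩
        ι (k ℕ.* w)                                     ≡⟨ ≡.cong ι (≡.trans (≡.cong (ℕ._* w) (≡.trans k≡k′p (ℕ.*-comm k′ p))) (ℕ.*-assoc p k′ w)) ⟩
        ι (p ℕ.* (k′ ℕ.* w))                            ≈⟨ ι-* p (k′ ℕ.* w) ⟩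
        ι p * ι (k′ ℕ.* w)                              ∎)
        where
        vanish : ι (k ℕ.* w) + ι p * y ≈ 0#
        vanish = +-cancelˡ (ι k) _ _ (begin
          ι k + (ι (k ℕ.* w) + ι p * y)     ≈⟨ R.+-assoc _ _ _ ⟨
          ι k + ι (k ℕ.* w) + ι p * y       ≈⟨ R.+-congʳ (×-homo-+ 1# k (k ℕ.* w)) ⟨
          ι (k ℕ.+ k ℕ.* w) + ι p * y       ≡⟨ ≡.cong (λ j → ι j + ι p * y) k^p ⟨
          ι (k ℕ.^ p) + ι p * y             ≈⟨ R.+-congʳ (ι-^ k p) ⟩
          ι k ^ p + ι p * y                 ≈⟨ eq ⟨
          φ p (ι k)                         ≈⟨ φ-ι p k ⟩
          ι k                               ≈⟨ R.+-identityʳ _ ⟨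
          ι k + 0#                          ∎)
          where
          open Algebra.Properties.Group R.+-group using () renaming (∙-cancelˡ to +-cancelˡ)

-- Arithmetic of the finite field.

module FieldProperties {c ℓ n} (F : FiniteField c ℓ n) where
  open FiniteField F using (commutativeRing; enumeration; invertible; 0≉1; _≈?_)
  open CommutativeRing commutativeRing hiding (zero)
  open Algebra.Properties.CommutativeSemiring.Exp commutativeSemiring
  open Algebra.Properties.Semiring.Mult semiring using (_×_)
  open Algebra.Properties.Ring ring using (-1*x≈-x)
  open Algebra.Properties.Group +-group using () renaming (∙-cancelˡ to +-cancelˡ)
  open Relation.Binary.Reasoning.Setoid setoid
  open Algebra.Solver.Ring.NaturalCoefficients.Default commutativeSemiring using (solve; _:+_; _:*_; _:=_)
  open Inverse enumeration using () renaming (from to elt; to to index; to-cong to index-cong; strictlyInverseˡ to index-elt; strictlyInverseʳ to elt-index)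

  *-cancelˡ-nonzero : ∀ {a} x y → ¬ a ≈ 0# → a * x ≈ a * y → x ≈ y
  *-cancelˡ-nonzero {a} x y a≉0 eq = let a⁻¹ , inv , _ = invertible a a≉0 in begin
    x               ≈⟨ *-identityˡ x ⟨
    1# * x          ≈⟨ *-congʳ inv ⟨
    a⁻¹ * a * x     ≈⟨ *-assoc a⁻¹ a x ⟩
    a⁻¹ * (a * x)   ≈⟨ *-congˡ eq ⟩
    a⁻¹ * (a * y)   ≈⟨ *-assoc a⁻¹ a y ⟨
    a⁻¹ * a * y     ≈⟨ *-congʳ inv ⟩
    1# * y          ≈⟨ *-identityˡ y ⟩
    y               ∎

  *-nonzero : ∀ {a b} → ¬ a ≈ 0# → ¬ b ≈ 0# → ¬ a * b ≈ 0#
  *-nonzero {a} {b} a≉0 b≉0 ab≈0 = b≉0 (*-cancelˡ-nonzero b 0# a≉0 (trans ab≈0 (sym (zeroʳ a))))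

  ^-nonzero : ∀ {a} k → ¬ a ≈ 0# → ¬ a ^ k ≈ 0#
  ^-nonzero zero    a≉0 1≈0 = 0≉1 (sym 1≈0)
  ^-nonzero (suc k) a≉0     = *-nonzero a≉0 (^-nonzero k a≉0)

  module _ {m ℓm} (M : CommutativeMonoid m ℓm) where
    private
      module M = CommutativeMonoid M
      module MΣ = Algebra.Properties.CommutativeMonoid.Sum M

    -- Stated for any commutative monoid because it serves products in the field, sums in the field
    -- and sums in the monoid ring.
    sum-reindex : ∀ {h h⁻¹ : Carrier → Carrier} →
      (∀ {a b} → a ≈ b → h a ≈ h b) → (∀ {a b} → a ≈ b → h⁻¹ a ≈ h⁻¹ b) →
      (∀ a → h (h⁻¹ a) ≈ a) → (∀ a → h⁻¹ (h a) ≈ a) →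
      ∀ {f : Carrier → M.Carrier} → (∀ {a b} → a ≈ b → f a M.≈ f b) →
      MΣ.sum (f ∘ elt) M.≈ MΣ.sum (f ∘ h ∘ elt)
    sum-reindex {h} {h⁻¹} h-cong h⁻¹-cong hh⁻¹ h⁻¹h {f} f-cong = M.trans
      (MΣ.sum-permute (f ∘ elt) (permutation (index ∘ h ∘ elt) (index ∘ h⁻¹ ∘ elt) (inv h-cong hh⁻¹) (inv h⁻¹-cong h⁻¹h)))
      (MΣ.sum-cong-≋ λ i → f-cong (elt-index (h (elt i))))
      where
      inv : ∀ {h h⁻¹ : Carrier → Carrier} → (∀ {a b} → a ≈ b → h a ≈ h b) → (∀ a → h (h⁻¹ a) ≈ a) →
            ∀ i → index (h (elt (index (h⁻¹ (elt i))))) ≡ i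
      inv h-cong hh⁻¹ i = ≡.trans (index-cong (trans (h-cong (elt-index _)) (hh⁻¹ (elt i)))) (index-elt i)

    sum-single : ∀ {k} (f : Fin k → M.Carrier) j → (∀ i → i ≢ j → f i M.≈ M.ε) → MΣ.sum f M.≈ f j
    sum-single {suc k} f zero    f≈ε = M.trans
      (M.∙-congˡ (M.trans (MΣ.sum-cong-≋ λ i → f≈ε (suc i) λ ()) (MΣ.sum-replicate-zero k)))
      (M.identityʳ (f zero))
    sum-single {suc k} f (suc j) f≈ε = M.trans
      (M.∙-congʳ (f≈ε zero λ ()))
      (M.trans (M.identityˡ _) (sum-single (f ∘ suc) j λ i i≢j → f≈ε (suc i) (i≢j ∘ Fin.suc-injective)))

    sum-scale : ∀ {a} → ¬ a ≈ 0# → ∀ {f : Carrier → M.Carrier} → (∀ {x y} → x ≈ y → f x M.≈ f y) →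
                MΣ.sum (f ∘ elt) M.≈ MΣ.sum (λ i → f (a * elt i))
    sum-scale {a} a≉0 = let a⁻¹ , invˡ , invʳ = invertible a a≉0 in
      sum-reindex {a *_} {a⁻¹ *_} *-congˡ *-congˡ
        (λ x → trans (sym (*-assoc _ _ x)) (trans (*-congʳ invʳ) (*-identityˡ x)))
        (λ x → trans (sym (*-assoc _ _ x)) (trans (*-congʳ invˡ) (*-identityˡ x)))

  private
    module Π = Algebra.Properties.CommutativeMonoid.Sum *-commutativeMonoid
    module Σ+ = Algebra.Properties.CommutativeMonoid.Sum +-commutativeMonoid

    ifZero : Carrier → Carrier → Carrier → Carrier
    ifZero x a b with x ≈? 0#
    ... | yes _ = a
    ... | no  _ = b

    ifZero-yes : ∀ {x a b} → x ≈ 0# → ifZero x a b ≈ a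
    ifZero-yes {x} x≈0 with x ≈? 0#
    ... | yes _   = refl
    ... | no  x≉0 = contradiction x≈0 x≉0

    ifZero-no : ∀ {x a b} → ¬ x ≈ 0# → ifZero x a b ≈ b
    ifZero-no {x} x≉0 with x ≈? 0#
    ... | yes x≈0 = contradiction x≈0 x≉0
    ... | no  _   = refl

    Π-nonzero : ∀ {k} (f : Fin k → Carrier) → (∀ i → ¬ f i ≈ 0#) → ¬ Π.sum f ≈ 0#
    Π-nonzero {zero}  f f≉0 1≈0 = 0≉1 (sym 1≈0)
    Π-nonzero {suc k} f f≉0     = *-nonzero (f≉0 zero) (Π-nonzero (f ∘ suc) (f≉0 ∘ suc))

  -- Multiplication by a permutes the nonzero elements, so the product of the
  -- n - 1 factors a belonging to them is 1.
  fermat : ∀ a .{{_ : NonZero n}} → a ^ n ≈ a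
  fermat a with a ≈? 0#
  ... | yes a≈0 = trans (^-congˡ n a≈0) (trans (Frobenius.0#^ commutativeRing n) (sym a≈0))
  ... | no  a≉0 = begin
    a ^ n                                  ≈⟨ Π.sum-replicate n ⟨
    Π.sum {n} (λ _ → a)                    ≈⟨ Π.sum-cong-≋ (λ i → split (elt i)) ⟩
    Π.sum (λ i → s (elt i) * r (elt i))    ≈⟨ Π.∑-distrib-+ (s ∘ elt) (r ∘ elt) ⟩
    Π.sum (s ∘ elt) * Π.sum (r ∘ elt)      ≈⟨ *-cong Πs≈1 Πr≈a ⟩
    1# * a                                 ≈⟨ *-identityˡ a ⟩
    a                                      ∎
    where
    -- `g` turns 0 into 1, so the product of its values is nonzero and can be cancelled; passing
    -- from `x` to `a * x` multiplies `g` by `s`. The factor `r` restores the single `a` that `s`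
    -- lacks at 0.
    s r g : Carrier → Carrier
    s x = ifZero x 1# a
    r x = ifZero x a 1#
    g x = ifZero x 1# x

    split : ∀ x → a ≈ s x * r x
    split x with x ≈? 0#
    ... | yes _ = sym (*-identityˡ a)
    ... | no  _ = sym (*-identityʳ a)

    g-cong : ∀ {x y} → x ≈ y → g x ≈ g y
    g-cong {x} {y} x≈y with x ≈? 0#
    ... | yes x≈0 = sym (ifZero-yes (trans (sym x≈y) x≈0))
    ... | no  x≉0 = trans x≈y (sym (ifZero-no (x≉0 ∘ trans x≈y)))

    g-scale : ∀ x → g (a * x) ≈ s x * g x
    g-scale x with x ≈? 0#
    ... | yes x≈0 = trans (ifZero-yes (trans (*-congˡ x≈0) (zeroʳ a))) (sym (*-identityˡ 1#))
    ... | no  x≉0 = ifZero-no (*-nonzero a≉0 x≉0)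

    g-nonzero : ∀ x → ¬ g x ≈ 0#
    g-nonzero x with x ≈? 0#
    ... | yes _   = 0≉1 ∘ sym
    ... | no  x≉0 = x≉0

    Πs≈1 : Π.sum (s ∘ elt) ≈ 1#
    Πs≈1 = *-cancelˡ-nonzero _ _ (Π-nonzero (g ∘ elt) (g-nonzero ∘ elt)) (begin
      Π.sum (g ∘ elt) * Π.sum (s ∘ elt)     ≈⟨ *-comm _ _ ⟩
      Π.sum (s ∘ elt) * Π.sum (g ∘ elt)     ≈⟨ Π.∑-distrib-+ (s ∘ elt) (g ∘ elt) ⟨
      Π.sum (λ i → s (elt i) * g (elt i))   ≈⟨ Π.sum-cong-≋ (λ i → g-scale (elt i)) ⟨
      Π.sum (λ i → g (a * elt i))           ≈⟨ sum-scale *-commutativeMonoid a≉0 g-cong ⟨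
      Π.sum (g ∘ elt)                       ≈⟨ *-identityʳ _ ⟨
      Π.sum (g ∘ elt) * 1#                  ∎)

    Πr≈a : Π.sum (r ∘ elt) ≈ a
    Πr≈a = trans (sum-single *-commutativeMonoid (r ∘ elt) (index 0#) λ i i≢ →
        ifZero-no λ eltᵢ≈0 → i≢ (≡.trans (≡.sym (index-elt i)) (index-cong eltᵢ≈0)))
      (ifZero-yes (elt-index 0#))

  -- Translation by 1 permutes the field, so the sum of all elements is unchanged although `n × 1#`
  -- has been added to it.
  cardinality-zero : n × 1# ≈ 0#
  cardinality-zero = sym (+-cancelˡ (Σ+.sum elt) _ _ (begin
    Σ+.sum elt + 0#                   ≈⟨ +-identityʳ _ ⟩
    Σ+.sum elt                        ≈⟨ sum-reindex +-commutativeMonoid {_+ 1#} {_+ - 1#} +-congʳ +-congʳ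
                                           (λ a → trans (+-assoc a _ _) (trans (+-congˡ (-‿inverseˡ 1#)) (+-identityʳ a)))
                                           (λ a → trans (+-assoc a _ _) (trans (+-congˡ (-‿inverseʳ 1#)) (+-identityʳ a))) {λ a → a} (λ a≈b → a≈b) ⟩
    Σ+.sum (λ i → elt i + 1#)         ≈⟨ Σ+.∑-distrib-+ elt (λ _ → 1#) ⟩
    Σ+.sum elt + Σ+.sum {n} (λ _ → 1#) ≈⟨ +-congˡ (Σ+.sum-replicate n) ⟩
    Σ+.sum elt + n × 1#               ∎))

  characteristic : ∀ p r → n ≡ p ℕ.^ r → p × 1# ≈ 0#
  characteristic p r n≡p^r with (p × 1#) ≈? 0#
  ... | yes p≈0 = p≈0
  ... | no  p≉0 = contradiction
    (trans (sym (Frobenius.ι-^ commutativeRing p r)) (trans (reflexive (≡.cong (_× 1#) (≡.sym n≡p^r))) cardinality-zero))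
    (^-nonzero r p≉0)

  -- The monic polynomial x ^ k + c_{k-1} x ^ (k-1) + ⋯ + c₀, in Horner form.
  monic : ∀ {k} → Vec Carrier k → Carrier → Carrier
  monic []       x = 1#
  monic (c ∷ cs) x = c + x * monic cs x

  -- The quotient of `monic (c ∷ cs)` by x - a, which does not depend on `c`; its coefficients are
  -- the intermediate values of Horner's scheme at `a`.
  deflate : ∀ {k} → Carrier → Vec Carrier k → Vec Carrier k
  deflate a []       = []
  deflate a (c ∷ cs) = monic (c ∷ cs) a ∷ deflate a cs

  -- f(x) - f(a) = (x - a) g(x), without subtraction.
  synthetic-division : ∀ {k} a x c (cs : Vec Carrier k) →
    monic (c ∷ cs) x + a * monic (deflate a cs) x ≈ monic (c ∷ cs) a + x * monic (deflate a cs) x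
  synthetic-division a x c [] = solve 4 (λ a x c o → (c :+ x :* o) :+ a :* o := (c :+ a :* o) :+ x :* o) refl a x c 1#
  synthetic-division a x c (d ∷ cs) = begin
    c + x * gx + a * (ga + x * h)   ≈⟨ solve 6 (λ a x c gx ga h → c :+ x :* gx :+ a :* (ga :+ x :* h) := c :+ a :* ga :+ x :* (gx :+ a :* h)) refl a x c gx ga h ⟩
    c + a * ga + x * (gx + a * h)   ≈⟨ +-congˡ (*-congˡ (synthetic-division a x d cs)) ⟩
    c + a * ga + x * (ga + x * h)   ∎
    where
    gx = monic (d ∷ cs) x
    ga = monic (d ∷ cs) a
    h  = monic (deflate a cs) x

  root-bound : ∀ {k s} (cs : Vec Carrier k) (a : Fin s → Carrier) →
               (∀ i j → a i ≈ a j → i ≡ j) → (∀ i → monic cs (a i) ≈ 0#) → s ≤ k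
  root-bound {s = zero}  cs       a a-inj root = z≤n
  root-bound {s = suc s} []       a a-inj root = contradiction (sym (root zero)) 0≉1
  root-bound {s = suc s} (c ∷ cs) a a-inj root = s≤s (root-bound (deflate a₀ cs) (a ∘ suc)
    (λ i j eq → Fin.suc-injective (a-inj (suc i) (suc j) eq)) root′)
    where
    a₀ = a zero
    root′ : ∀ i → monic (deflate a₀ cs) (a (suc i)) ≈ 0#
    root′ i with monic (deflate a₀ cs) (a (suc i)) ≈? 0#
    ... | yes eq = eq
    ... | no  g≉0 = contradiction (a-inj zero (suc i) (*-cancelˡ-nonzero a₀ x g≉0 (trans (*-comm g a₀) (trans a₀g≈xg (*-comm x g))))) λ ()
      where
      x = a (suc i)
      g = monic (deflate a₀ cs) x
      a₀g≈xg : a₀ * g ≈ x * g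
      a₀g≈xg = begin
        a₀ * g                           ≈⟨ +-identityˡ _ ⟨
        0# + a₀ * g                      ≈⟨ +-congʳ (root (suc i)) ⟨
        monic (c ∷ cs) x + a₀ * g        ≈⟨ synthetic-division a₀ x c cs ⟩
        monic (c ∷ cs) a₀ + x * g        ≈⟨ +-congʳ (root zero) ⟩
        0# + x * g                       ≈⟨ +-identityˡ _ ⟩
        x * g                            ∎

  -- Otherwise all `n` elements would be roots of x ^ k - x, which is monic of degree `k < n`
  -- because `1 < k` keeps the linear term below the leading one.
  ^-nontrivial : ∀ k → 1 < k → k < n → ∃[ a ] ¬ a ^ k ≈ a
  ^-nontrivial (suc zero) (s≤s ()) _
  ^-nontrivial k@(suc (suc j)) _ k<n with Fin.any? (λ i → ¬? ((elt i ^ k) ≈? elt i))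
    where open import Relation.Nullary.Decidable using (¬?)
  ... | yes (i , neq) = elt i , neq
  ... | no  none      = contradiction (root-bound cs elt elt-inj root) (ℕ.<⇒≱ k<n)
    where
    cs : Vec Carrier k
    cs = 0# ∷ - 1# ∷ Vec.replicate j 0#
    elt-inj : ∀ i j → elt i ≈ elt j → i ≡ j
    elt-inj i j eq = ≡.trans (≡.sym (index-elt i)) (≡.trans (index-cong eq) (index-elt j))
    monic-replicate : ∀ j x → monic (Vec.replicate j 0#) x ≈ x ^ j
    monic-replicate zero    x = refl
    monic-replicate (suc j) x = trans (+-identityˡ _) (*-congˡ (monic-replicate j x))
    root : ∀ i → monic cs (elt i) ≈ 0#
    root i with (elt i ^ k) ≈? elt i
    ... | no  neq = contradiction (i , neq) none
    ... | yes eq  = begin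
      0# + x * (- 1# + x * monic (Vec.replicate j 0#) x)   ≈⟨ +-identityˡ _ ⟩
      x * (- 1# + x * monic (Vec.replicate j 0#) x)        ≈⟨ *-congˡ (+-congˡ (*-congˡ (monic-replicate j x))) ⟩
      x * (- 1# + x ^ suc j)                               ≈⟨ distribˡ x _ _ ⟩
      x * - 1# + x ^ k                                     ≈⟨ +-cong (trans (*-comm x _) (-1*x≈-x x)) eq ⟩
      - x + x                                              ≈⟨ -‿inverseˡ x ⟩
      0#                                                   ∎
      where x = elt i

  -- By `fermat` a positive exponent matters only modulo n - 1. The representative is chosen among
  -- 1, ..., n - 1 so that `a` may be 0.
  ^-reduce : ∀ a k .{{_ : NonZero n}} .{{_ : NonZero (pred n)}} → a ^ suc k ≈ a ^ suc (k % pred n)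
  ^-reduce a k = trans (reflexive (≡.cong (λ k → a ^ suc k) (m≡m%n+[m/n]*n k (pred n)))) (loop (k ℕ./ pred n))
    where
    r = k % pred n
    loop : ∀ d → a ^ suc (r ℕ.+ d ℕ.* pred n) ≈ a ^ suc r
    loop zero    = reflexive (≡.cong (λ k → a ^ suc k) (ℕ.+-identityʳ r))
    loop (suc d) = begin
      a ^ suc (r ℕ.+ (pred n ℕ.+ d ℕ.* pred n))         ≡⟨ ≡.cong (a ^_) rearrange ⟩
      a ^ (n ℕ.+ (r ℕ.+ d ℕ.* pred n))                  ≈⟨ ^-homo-* a n _ ⟩
      a ^ n * a ^ (r ℕ.+ d ℕ.* pred n)                  ≈⟨ *-congʳ (fermat a) ⟩
      a ^ suc (r ℕ.+ d ℕ.* pred n)                      ≈⟨ loop d ⟩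
      a ^ suc r                                         ∎
      where
      rearrange : suc (r ℕ.+ (pred n ℕ.+ d ℕ.* pred n)) ≡ n ℕ.+ (r ℕ.+ d ℕ.* pred n)
      rearrange = ≡.trans (≡.cong suc (≡.trans (≡.sym (ℕ.+-assoc r (pred n) _))
        (≡.trans (≡.cong (ℕ._+ d ℕ.* pred n) (ℕ.+-comm r (pred n))) (ℕ.+-assoc (pred n) r _))))
        (≡.cong (ℕ._+ (r ℕ.+ d ℕ.* pred n)) (ℕ.suc-pred n))

  ^-nontrivial-∤ : ∀ k .{{_ : NonZero n}} .{{_ : NonZero (pred n)}} → ¬ pred n ∣ k →
                   ∃[ a ] ¬ a ≈ 0# ∧ ¬ a ^ k ≈ 1#
  -- A nonzero remainder puts the reduced exponent strictly between 1 and `n`. An element that this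
  -- power moves is not 0, and its `k`-th power is not 1.
  ^-nontrivial-∤ k n-1∤k = let a , a^≉a = ^-nontrivial (suc (k % pred n)) (s≤s (ℕ.n≢0⇒n>0 (n-1∤k ∘ m%n≡0⇒n∣m k (pred n))))
                                    (≡.subst (suc (k % pred n) <_) (ℕ.suc-pred n) (s≤s (m%n<n k (pred n))))
    in a , (λ a≈0 → a^≉a (trans (*-congʳ a≈0) (trans (zeroˡ _) (sym a≈0))))
         , (λ a^k≈1 → a^≉a (trans (sym (^-reduce a k)) (trans (*-congˡ a^k≈1) (*-identityʳ a))))

-- Power sums over the field, lifted to the monoid ring.

module PowerSums {c ℓ n} (F : FiniteField c ℓ n) where
  open MonoidRing F
  open FieldProperties F
  open FiniteField F using (enumeration; invertible) renaming (commutativeRing to fieldRing)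
  private module F = CommutativeRing fieldRing
  open Algebra.Properties.Semiring.Sum semiring
  open Frobenius ring using (ι; ι-^)
  open IdealPowers ring fieldRing ε-homo
  open Relation.Binary.Reasoning.Setoid setoid
  private
    elt = Inverse.from enumeration
    module F^ = Algebra.Properties.CommutativeSemiring.Exp F.commutativeSemiring

  fieldPowerSum : ℕ → Expr
  fieldPowerSum k = sum (λ i → gen (elt i) ^ k)

  -- With exponent 0 every summand is 1, the one for the element 0 included, so the sum is `p ^ r`.
  fieldPowerSum-0 : ∀ {p} r → n ≡ p ℕ.^ r → Kernel (ι p) → fieldPowerSum 0 ∈I^ r
  fieldPowerSum-0 {p} r n≡p^r p∈I = resp (begin
    ι p ^ r              ≈⟨ ι-^ p r ⟨
    ι (p ℕ.^ r)          ≡⟨ ≡.cong ι n≡p^r ⟨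
    ι n                  ≈⟨ sum-replicate n ⟨
    fieldPowerSum 0      ∎)
    (≡.subst (ι p ^ r ∈I^_) (ℕ.*-identityʳ r) (I^-^ r (Kernel⇒I^1 p∈I)))

  -- Scaling by some a with aᵏ ≠ 1 fixes the sum, and 1 - [a]ᵏ is invertible modulo I.
  fieldPowerSum-∤ : ∀ k .{{_ : NonZero n}} .{{_ : NonZero (pred n)}} → ¬ pred n ∣ k → ∀ r → fieldPowerSum k ∈I^ r
  fieldPowerSum-∤ k n-1∤k = go
    where
    P = fieldPowerSum k
    found = ^-nontrivial-∤ k n-1∤k
    a = proj₁ found
    d = F.1# F.- a F^.^ k
    d≉0 : ¬ d F.≈ F.0#
    d≉0 d≈0 = proj₂ (proj₂ found) (F.sym (x∙y⁻¹≈ε⇒x≈y _ _ d≈0))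
      where open Algebra.Properties.Group F.+-group using (x∙y⁻¹≈ε⇒x≈y)
    d⁻¹ = proj₁ (invertible d d≉0)

    P-scale : P ≈ gen a ^ k * P
    P-scale = begin
      P                                          ≈⟨ sum-scale +-commutativeMonoid (proj₁ (proj₂ found)) (λ x≈y → ^-congˡ k (gen-cong x≈y)) ⟩
      sum (λ i → gen (a F.* elt i) ^ k)          ≈⟨ sum-cong-≋ (λ i → trans (^-congˡ k (gen-* a (elt i))) (^-distrib-* (gen a) (gen (elt i)) k)) ⟩
      sum (λ i → gen a ^ k * gen (elt i) ^ k)    ≈⟨ *-distribˡ-sum (gen a ^ k) (λ i → gen (elt i) ^ k) ⟨
      gen a ^ k * P                              ∎

    -- `ε w` is `d`, so `z` lies in `I`. As `w` annihilates `P`, multiplication by `z` fixes `P`,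
    -- and it can be repeated `r` times.
    w z : Expr
    w = 1# + - (gen a ^ k)
    z = 1# + - (gen d⁻¹ * w)

    wP≈0 : w * P ≈ 0#
    wP≈0 = begin
      w * P                          ≈⟨ R.distribʳ P 1# (- (gen a ^ k)) ⟩
      1# * P + - (gen a ^ k) * P     ≈⟨ R.+-cong (R.*-identityˡ P) (sym (-‿distribˡ-* (gen a ^ k) P)) ⟩
      P + - (gen a ^ k * P)          ≈⟨ R.+-congˡ (R.-‿cong P-scale) ⟨
      P + - P                        ≈⟨ R.-‿inverseʳ P ⟩
      0#                             ∎
      where open Algebra.Properties.Ring R.ring using (-‿distribˡ-*)

    z∈I : Kernel z
    z∈I = kernel (F.trans (F.+-congˡ (F.-‿cong (F.trans
        (F.*-congˡ (F.+-congˡ (F.-‿cong (F.sym (ε-cong (gen-^ a k))))))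
        (proj₁ (proj₂ (invertible d d≉0))))))
      (F.-‿inverseʳ F.1#))

    zP≈P : z * P ≈ P
    zP≈P = begin
      z * P                                  ≈⟨ R.distribʳ P 1# (- (gen d⁻¹ * w)) ⟩
      1# * P + - (gen d⁻¹ * w) * P           ≈⟨ R.+-cong (R.*-identityˡ P) (sym (-‿distribˡ-* (gen d⁻¹ * w) P)) ⟩
      P + - (gen d⁻¹ * w * P)                ≈⟨ R.+-congˡ (R.-‿cong (trans (R.*-assoc (gen d⁻¹) w P) (trans (R.*-congˡ {gen d⁻¹} wP≈0) (R.zeroʳ (gen d⁻¹))))) ⟩
      P + - 0#                               ≈⟨ R.+-congˡ -0#≈0# ⟩
      P + 0#                                 ≈⟨ R.+-identityʳ P ⟩
      P                                      ∎
      where open Algebra.Properties.Ring R.ring using (-‿distribˡ-*; -0#≈0#)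

    go : ∀ r → P ∈I^ r
    go zero    = all
    go (suc r) = resp zP≈P (product z∈I (go r))

-- Families Z → R spanned by the monomials c ∏ⱼ gⱼ ^ (p ^ lⱼ) in the generators
-- with at most w + v (p - 1) factors, where p ^ v ∣ c, and of degree D modulo N.
-- Only p-power exponents occur, so the number of factors plays the role of
-- the base p digit sum of the exponents, and v that of a lower bound for the
-- valuation of multinomial coefficients.
module Weights {a ℓ} (R : CommutativeRing a ℓ) {p} (pr : Prime p) (N : ℕ)
  {g z} {Gen : Set g} {Z : Set z} (value : Gen → Z → CommutativeRing.Carrier R) (deg : Gen → ℕ) where

  open CommutativeRing R hiding (zero)
  open Algebra.Properties.CommutativeSemiring.Exp commutativeSemiring
  open Algebra.Properties.Semiring.Mult semiring using (_×_)
  open Algebra.Properties.Semiring.Sum semiring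
  open Frobenius R
  open Relation.Binary.Reasoning.Setoid setoid

  private instance
    p-nonZero : NonZero p
    p-nonZero = prime⇒nonZero pr

  Monomial : Set g
  Monomial = List (Gen ∧ ℕ)

  degree : Monomial → ℕ
  degree ls = ℕ.sum (List.map (λ (x , l) → p ℕ.^ l ℕ.* deg x) ls)

  ⟦_⟧ : Monomial → Z → Carrier
  ⟦ []           ⟧ z = 1#
  ⟦ (x , l) ∷ ls ⟧ z = value x z ^ (p ℕ.^ l) * ⟦ ls ⟧ z

  data Weighted (D w : ℕ) : (Z → Carrier) → Set (a ⊔ ℓ ⊔ g ⊔ z) where
    zeros : Weighted D w (λ _ → 0#)
    plus  : ∀ {f h} → Weighted D w f → Weighted D w h → Weighted D w (λ z → f z + h z)
    resp  : ∀ {f h} → (∀ z → f z ≈ h z) → Weighted D w f → Weighted D w h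
    term  : ∀ c v ls → p ℕ.^ v ∣ c → length ls ≤ w ℕ.+ v ℕ.* pred p →
            (∃[ b ] degree ls ≡ D ℕ.+ N ℕ.* b) → Weighted D w (λ z → ι c * ⟦ ls ⟧ z)

  weighted-≡ : ∀ {D D′ w w′ f} → D ≡ D′ → w ≡ w′ → Weighted D w f → Weighted D′ w′ f
  weighted-≡ ≡.refl ≡.refl h = h

  generator : ∀ x b → deg x ≡ 1 ℕ.+ N ℕ.* b → Weighted 1 1 (value x)
  generator x b deg≡ = resp (λ z → begin
      ι 1 * (value x z ^ 1 * 1#)   ≈⟨ *-cong (+-identityʳ 1#) (*-identityʳ _) ⟩
      1# * value x z ^ 1           ≈⟨ *-identityˡ _ ⟩
      value x z ^ 1                ≈⟨ *-identityʳ _ ⟩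
      value x z                    ∎)
    (term 1 0 ((x , 0) ∷ []) (1∣ 1) (s≤s z≤n) (b , ≡.trans (≡.trans (ℕ.+-identityʳ _) (ℕ.+-identityʳ _)) deg≡))

  one : Weighted 0 0 (λ _ → 1#)
  one = resp (λ z → trans (*-congʳ (+-identityʳ 1#)) (*-identityʳ 1#))
    (term 1 0 [] (1∣ 1) z≤n (0 , ≡.sym (ℕ.*-zeroʳ N)))

  ι-weighted : ∀ {D w f} c → Weighted D w f → Weighted D w (λ z → ι c * f z)
  ι-weighted c zeros       = resp (λ _ → sym (zeroʳ (ι c))) zeros
  ι-weighted c (plus h h′) = resp (λ _ → sym (distribˡ (ι c) _ _)) (plus (ι-weighted c h) (ι-weighted c h′))
  ι-weighted c (resp eq h) = resp (λ z → *-congˡ (eq z)) (ι-weighted c h)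
  ι-weighted c (term d v ls p^v∣d len deg) =
    resp (λ z → trans (*-congʳ (ι-* c d)) (*-assoc _ _ _)) (term (c ℕ.* d) v ls (∣n⇒∣m*n c p^v∣d) len deg)

  -- A further factor `p` in the coefficient raises `v` by one, which pays for `p - 1` more
  -- generators.
  p-weighted : ∀ {D w f} → Weighted D (w ℕ.+ pred p) f → Weighted D w (λ z → ι p * f z)
  p-weighted zeros       = resp (λ _ → sym (zeroʳ (ι p))) zeros
  p-weighted (plus h h′) = resp (λ _ → sym (distribˡ (ι p) _ _)) (plus (p-weighted h) (p-weighted h′))
  p-weighted (resp eq h) = resp (λ z → *-congˡ (eq z)) (p-weighted h)
  p-weighted {w = w} (term d v ls p^v∣d len deg) =
    resp (λ z → trans (*-congʳ (ι-* p d)) (*-assoc _ _ _))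
      (term (p ℕ.* d) (suc v) ls (*-monoʳ-∣ p p^v∣d) (≡.subst (length ls ≤_) (ℕ.+-assoc w (pred p) _) len) deg)

  ⟦++⟧ : ∀ ls ls′ z → ⟦ ls ++ ls′ ⟧ z ≈ ⟦ ls ⟧ z * ⟦ ls′ ⟧ z
  ⟦++⟧ []       ls′ z = sym (*-identityˡ _)
  ⟦++⟧ (_ ∷ ls) ls′ z = trans (*-congˡ (⟦++⟧ ls ls′ z)) (sym (*-assoc _ _ _))

  degree-++ : ∀ ls ls′ → degree (ls ++ ls′) ≡ degree ls ℕ.+ degree ls′
  degree-++ []             ls′ = ≡.refl
  degree-++ ((x , l) ∷ ls) ls′ = ≡.trans (≡.cong (p ℕ.^ l ℕ.* deg x ℕ.+_) (degree-++ ls ls′)) (≡.sym (ℕ.+-assoc (p ℕ.^ l ℕ.* deg x) _ _))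

  weighted-* : ∀ {D D′ w w′ f h} → Weighted D w f → Weighted D′ w′ h →
               Weighted (D ℕ.+ D′) (w ℕ.+ w′) (λ z → f z * h z)
  weighted-* zeros h′        = resp (λ _ → sym (zeroˡ _)) zeros
  weighted-* (plus h₁ h₂) h′ = resp (λ _ → sym (distribʳ _ _ _)) (plus (weighted-* h₁ h′) (weighted-* h₂ h′))
  weighted-* (resp eq h) h′  = resp (λ z → *-congʳ (eq z)) (weighted-* h h′)
  weighted-* t@(term _ _ _ _ _ _) zeros        = resp (λ _ → sym (zeroʳ _)) zeros
  weighted-* t@(term _ _ _ _ _ _) (plus h₁ h₂) = resp (λ _ → sym (distribˡ _ _ _)) (plus (weighted-* t h₁) (weighted-* t h₂))
  weighted-* t@(term _ _ _ _ _ _) (resp eq h)  = resp (λ z → *-congˡ (eq z)) (weighted-* t h)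
  weighted-* {D} {D′} {w} {w′} (term c v ls p^v∣c len (b , deg≡)) (term c′ v′ ls′ p^v′∣c′ len′ (b′ , deg≡′)) =
    resp (λ z → trans (*-cong (ι-* c c′) (⟦++⟧ ls ls′ z))
                      (R-solve 4 (λ a b m n → (a R-* b) R-* (m R-* n) R-= (a R-* m) R-* (b R-* n)) refl _ _ _ _))
      (term (c ℕ.* c′) (v ℕ.+ v′) (ls ++ ls′)
        (≡.subst (_∣ c ℕ.* c′) (≡.sym (ℕ.^-distribˡ-+-* p v v′)) (*-pres-∣ p^v∣c p^v′∣c′))
        (≡.subst₂ _≤_ (≡.sym (List.length-++ ls)) (solve 5 (λ w w′ v v′ p → (w :+ v :* p) :+ (w′ :+ v′ :* p) := w :+ w′ :+ (v :+ v′) :* p) ≡.refl w w′ v v′ (pred p)) (ℕ.+-mono-≤ len len′))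
        (b ℕ.+ b′ , ≡.trans (degree-++ ls ls′) (≡.trans (≡.cong₂ ℕ._+_ deg≡ deg≡′)
          (solve 5 (λ D D′ N b b′ → (D :+ N :* b) :+ (D′ :+ N :* b′) := D :+ D′ :+ N :* (b :+ b′)) ≡.refl D D′ N b b′))))
    where
    open +-*-Solver
    open Algebra.Solver.Ring.NaturalCoefficients.Default commutativeSemiring using () renaming (solve to R-solve; _:*_ to _R-*_; _:=_ to _R-=_)

  weighted-^ : ∀ {D w f} k → Weighted D w f → Weighted (k ℕ.* D) (k ℕ.* w) (λ z → f z ^ k)
  weighted-^ zero    h = one
  weighted-^ (suc k) h = weighted-* h (weighted-^ k h)

  weighted-sum : ∀ {D w k} {f : Fin k → Z → Carrier} → (∀ i → Weighted D w (f i)) → Weighted D w (λ z → sum (λ i → f i z))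
  weighted-sum {k = zero}  h = zeros
  weighted-sum {k = suc k} h = plus (h zero) (weighted-sum (h ∘ suc))

  shift : Monomial → Monomial
  shift = List.map (λ (x , l) → x , suc l)

  ⟦shift⟧ : ∀ ls z → ⟦ shift ls ⟧ z ≈ ⟦ ls ⟧ z ^ p
  ⟦shift⟧ []             z = sym (1#^ p)
  ⟦shift⟧ ((x , l) ∷ ls) z = begin
    value x z ^ (p ℕ.* p ℕ.^ l) * ⟦ shift ls ⟧ z    ≈⟨ *-cong (trans (^-congʳ _ (ℕ.*-comm p (p ℕ.^ l))) (sym (^-assocʳ _ (p ℕ.^ l) p))) (⟦shift⟧ ls z) ⟩
    (value x z ^ (p ℕ.^ l)) ^ p * ⟦ ls ⟧ z ^ p      ≈⟨ ^-distrib-* _ _ p ⟨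
    (value x z ^ (p ℕ.^ l) * ⟦ ls ⟧ z) ^ p          ∎

  degree-shift : ∀ ls → degree (shift ls) ≡ p ℕ.* degree ls
  degree-shift []             = ≡.sym (ℕ.*-zeroʳ p)
  degree-shift ((x , l) ∷ ls) = ≡.trans (≡.cong₂ ℕ._+_ (ℕ.*-assoc p (p ℕ.^ l) (deg x)) (degree-shift ls)) (≡.sym (ℕ.*-distribˡ-+ p _ _))

  -- The cross terms have p factors of weight 1, and gain weight p - 1 from the coefficient p.
  weighted-frobenius : ∀ {D f} → Weighted D 1 f → Weighted (p ℕ.* D) 1 (λ z → f z ^ p)
  weighted-frobenius zeros = resp (λ _ → sym (0#^ p)) zeros
  weighted-frobenius {D} (plus {f} {h} F H) = resp (λ z → sym (frobenius pr (f z) (h z)))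
    (plus (plus (weighted-frobenius F) (weighted-frobenius H)) (p-weighted (weighted-sum {f = λ i z → crossTerm p (f z) (h z) i} λ i →
      let k = suc (toℕ i)
          k≤p : k ≤ p
          k≤p = ℕ.≤-trans (Fin.toℕ<n i) (ℕ.pred[n]≤n {p})
          split : ∀ D → k ℕ.* D ℕ.+ (p ∸ k) ℕ.* D ≡ p ℕ.* D
          split D = ≡.trans (≡.sym (ℕ.*-distribʳ-+ D k (p ∸ k))) (≡.cong (ℕ._* D) (ℕ.m+[n∸m]≡n k≤p))
      in resp (λ z → sym (×-ι ((p C k) ℕ./ p) _)) (ι-weighted ((p C k) ℕ./ p)
        (weighted-≡ (split D) (≡.trans (split 1) (≡.trans (ℕ.*-identityʳ p) (≡.sym (ℕ.suc-pred p))))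
          (weighted-* (weighted-^ k F) (weighted-^ (p ∸ k) H)))))))
  weighted-frobenius (resp eq h) = resp (λ z → ^-congˡ p (eq z)) (weighted-frobenius h)
  -- A single term keeps its number of factors, each `l` growing by one, and `c ∣ c ^ p` preserves
  -- `v`.
  weighted-frobenius {D} (term c v ls p^v∣c len (b , deg≡)) =
    resp (λ z → trans (*-cong (ι-^ c p) (⟦shift⟧ ls z)) (sym (^-distrib-* _ _ p)))
      (term (c ℕ.^ p) v (shift ls) (∣-trans p^v∣c c∣c^p) (≡.subst (_≤ _) (≡.sym (List.length-map _ ls)) len)
        (p ℕ.* b , ≡.trans (degree-shift ls) (≡.trans (≡.cong (p ℕ.*_) deg≡)
          (solve 4 (λ p D N b → p :* (D :+ N :* b) := p :* D :+ N :* (p :* b)) ≡.refl p D N b))))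
    where
    open +-*-Solver
    c∣c^p : c ∣ c ℕ.^ p
    c∣c^p = ≡.subst (λ k → c ∣ c ℕ.^ k) (ℕ.suc-pred p) (m∣m*n (c ℕ.^ pred p))

  weighted-^p^ : ∀ {D f} r → Weighted D 1 f → Weighted (p ℕ.^ r ℕ.* D) 1 (λ z → f z ^ (p ℕ.^ r))
  weighted-^p^ {D} zero    h = weighted-≡ (≡.sym (ℕ.+-identityʳ D)) ≡.refl (resp (λ _ → sym (*-identityʳ _)) h)
  weighted-^p^ {D} (suc r) h = weighted-≡ (≡.sym (ℕ.*-assoc p (p ℕ.^ r) D)) ≡.refl
    (resp (λ z → trans (^-assocʳ _ (p ℕ.^ r) p) (^-congʳ _ (ℕ.*-comm (p ℕ.^ r) p))) (weighted-frobenius (weighted-^p^ r h)))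

  -- The base p digits of p ^ s - 1 are all p - 1, so the exponent is the sum of (p - 1) p ^ (r + i)
  -- over i < s. Each of the s blocks consists of p - 1 factors of weight 1.
  weighted-^pred : ∀ {f} r s → Weighted 1 1 f →
    let M = p ℕ.^ r ℕ.* pred (p ℕ.^ s) in Weighted M (s ℕ.* pred p) (λ z → f z ^ M)
  weighted-^pred {f} r s h = ≡.subst (λ P → Weighted (p ℕ.^ r ℕ.* P) (s ℕ.* pred p) (λ z → f z ^ (p ℕ.^ r ℕ.* P))) (≡.sym (pred-^ p s)) (go s)
    where
    M : ℕ → ℕ
    M s = p ℕ.^ r ℕ.* (pred p ℕ.* ∑ s (p ℕ.^_))
    M-suc : ∀ s → p ℕ.^ (r ℕ.+ s) ℕ.* pred p ℕ.+ M s ≡ M (suc s)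
    M-suc s = ≡.trans (≡.cong (λ x → x ℕ.* pred p ℕ.+ M s) (ℕ.^-distribˡ-+-* p r s))
      (solve 4 (λ a b c d → a :* b :* c :+ a :* (c :* d) := a :* (c :* (d :+ b))) ≡.refl (p ℕ.^ r) (p ℕ.^ s) (pred p) (∑ s (p ℕ.^_)))
      where open +-*-Solver
    go : ∀ s → Weighted (M s) (s ℕ.* pred p) (λ z → f z ^ M s)
    go zero rewrite ℕ.*-zeroʳ (pred p) | ℕ.*-zeroʳ (p ℕ.^ r) = one
    go (suc s) = weighted-≡
      (≡.trans (≡.cong (ℕ._+ M s) (≡.trans (≡.cong (pred p ℕ.*_) (ℕ.*-identityʳ (p ℕ.^ (r ℕ.+ s)))) (ℕ.*-comm (pred p) (p ℕ.^ (r ℕ.+ s))))) (M-suc s))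
      (≡.cong (ℕ._+ s ℕ.* pred p) (ℕ.*-identityʳ (pred p)))
      (resp (λ z → trans (*-congʳ (^-assocʳ _ (p ℕ.^ (r ℕ.+ s)) (pred p))) (trans (sym (^-homo-* (f z) (p ℕ.^ (r ℕ.+ s) ℕ.* pred p) (M s))) (^-congʳ (f z) (M-suc s))))
        (weighted-* (weighted-^ (pred p) (weighted-^p^ (r ℕ.+ s) h)) (go s)))

-- Sums over lists and products of powers.

module ListSums {a ℓ} (R : CommutativeRing a ℓ) where
  open CommutativeRing R hiding (zero)
  open Algebra.Properties.Semiring.Sum semiring
  open Relation.Binary.Reasoning.Setoid setoid
  open Algebra.Solver.Ring.NaturalCoefficients.Default commutativeSemiring using (solve; _:+_; _:*_; _:=_)

  ∑L : ∀ {z} {Z : Set z} → List Z → (Z → Carrier) → Carrier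
  ∑L []       f = 0#
  ∑L (z ∷ zs) f = f z + ∑L zs f

  module _ {z} {Z : Set z} where

    ∑L-cong : ∀ (zs : List Z) {f g : Z → Carrier} → (∀ z → f z ≈ g z) → ∑L zs f ≈ ∑L zs g
    ∑L-cong []       f≈g = refl
    ∑L-cong (z ∷ zs) f≈g = +-cong (f≈g z) (∑L-cong zs f≈g)

    ∑L-zero : ∀ (zs : List Z) → ∑L zs (λ _ → 0#) ≈ 0#
    ∑L-zero []       = refl
    ∑L-zero (z ∷ zs) = trans (+-identityˡ _) (∑L-zero zs)

    ∑L-+ : ∀ (zs : List Z) (f g : Z → Carrier) → ∑L zs (λ z → f z + g z) ≈ ∑L zs f + ∑L zs g
    ∑L-+ []       f g = sym (+-identityˡ 0#)
    ∑L-+ (z ∷ zs) f g = trans (+-congˡ (∑L-+ zs f g))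
      (solve 4 (λ a b c d → (a :+ b) :+ (c :+ d) := (a :+ c) :+ (b :+ d)) refl (f z) (g z) (∑L zs f) (∑L zs g))

    ∑L-*ˡ : ∀ (zs : List Z) c (f : Z → Carrier) → ∑L zs (λ z → c * f z) ≈ c * ∑L zs f
    ∑L-*ˡ []       c f = sym (zeroʳ c)
    ∑L-*ˡ (z ∷ zs) c f = trans (+-congˡ (∑L-*ˡ zs c f)) (sym (distribˡ c _ _))

    ∑L-++ : ∀ (xs ys : List Z) (f : Z → Carrier) → ∑L (xs ++ ys) f ≈ ∑L xs f + ∑L ys f
    ∑L-++ []       ys f = sym (+-identityˡ _)
    ∑L-++ (x ∷ xs) ys f = trans (+-congˡ (∑L-++ xs ys f)) (sym (+-assoc _ _ _))

    ∑L-map : ∀ {y} {Y : Set y} (h : Y → Z) ys (f : Z → Carrier) → ∑L (List.map h ys) f ≡ ∑L ys (f ∘ h)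
    ∑L-map h []       f = ≡.refl
    ∑L-map h (y ∷ ys) f = ≡.cong (f (h y) +_) (∑L-map h ys f)

    ∑L-tabulate : ∀ {n} (h : Fin n → Z) (f : Z → Carrier) → ∑L (List.tabulate h) f ≡ sum (f ∘ h)
    ∑L-tabulate {zero}  h f = ≡.refl
    ∑L-tabulate {suc n} h f = ≡.cong (f (h zero) +_) (∑L-tabulate (h ∘ suc) f)

  module _ {z} {Z : Set z} where

    ∑L-cartesianProductWith : ∀ {x y} {X : Set x} {Y : Set y} (_∙_ : X → Y → Z) xs ys
      {f : Z → Carrier} {g : X → Carrier} {h : Y → Carrier} → (∀ x y → f (x ∙ y) ≈ g x * h y) →
      ∑L (List.cartesianProductWith _∙_ xs ys) f ≈ ∑L xs g * ∑L ys h
    ∑L-cartesianProductWith _∙_ []       ys eq = sym (zeroˡ _)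
    ∑L-cartesianProductWith _∙_ (x ∷ xs) ys {f} {g} {h} eq = begin
      ∑L (List.map (x ∙_) ys ++ List.cartesianProductWith _∙_ xs ys) f
        ≈⟨ ∑L-++ (List.map (x ∙_) ys) _ f ⟩
      ∑L (List.map (x ∙_) ys) f + ∑L (List.cartesianProductWith _∙_ xs ys) f
        ≈⟨ +-cong (trans (reflexive (∑L-map (x ∙_) ys f)) (trans (∑L-cong ys (eq x)) (∑L-*ˡ ys (g x) h)))
                  (∑L-cartesianProductWith _∙_ xs ys eq) ⟩
      g x * ∑L ys h + ∑L xs g * ∑L ys h
        ≈⟨ distribʳ _ _ _ ⟨
      (g x + ∑L xs g) * ∑L ys h ∎

module MonomialProducts {a ℓ} (R : CommutativeRing a ℓ) where
  open CommutativeRing R hiding (zero)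
  open Algebra.Properties.CommutativeSemiring.Exp commutativeSemiring
  private module Π = Algebra.Properties.CommutativeMonoid.Sum *-commutativeMonoid

  ∏^ : ∀ {k} → (Fin k → Carrier) → (Fin k → ℕ) → Carrier
  ∏^ a u = Π.sum (λ j → a j ^ u j)

  ∏^-+ : ∀ {k} (a : Fin k → Carrier) u v → ∏^ a (λ j → u j ℕ.+ v j) ≈ ∏^ a u * ∏^ a v
  ∏^-+ a u v = trans (Π.sum-cong-≋ λ j → ^-homo-* (a j) (u j) (v j)) (Π.∑-distrib-+ (λ j → a j ^ u j) (λ j → a j ^ v j))

  ∏^-^ : ∀ {k} (a : Fin k → Carrier) u n → ∏^ a u ^ n ≈ ∏^ a (λ j → n ℕ.* u j)
  ∏^-^ {k} a u zero    = sym (Π.sum-replicate-zero k)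
  ∏^-^ a u (suc n) = trans (*-congˡ (∏^-^ a u n)) (sym (∏^-+ a u (λ j → n ℕ.* u j)))

-- Sums of monomials over all points.

module _ {c ℓ} (p e m k W : ℕ) .{{_ : NonTrivial (p ℕ.^ e)}} .{{_ : NonZero e}} .{{_ : NonZero m}} .{{_ : NonZero W}}
         (pr : Prime p) (F : FiniteField c ℓ ((p ℕ.^ e) ℕ.^ m)) where

  open FiniteField F using (elements; enumeration; _≈?_) renaming (commutativeRing to fieldRing)
  open MonoidRing F
  open FieldProperties F
  open PowerSums F
  open Frobenius ring
  open IdealPowers ring fieldRing ε-homo
  open ListSums ring
  open MonomialProducts ring
  open Relation.Binary.Reasoning.Setoid setoid
  open Algebra.Solver.Ring.NaturalCoefficients.Default commutativeSemiring using (solve; _:+_; _:*_; _:=_)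
  private
    module F  = CommutativeRing fieldRing
    module F^ = Algebra.Properties.CommutativeSemiring.Exp F.commutativeSemiring
    module F× = Algebra.Properties.Semiring.Mult F.semiring
    module Π  = Algebra.Properties.CommutativeMonoid.Sum *-commutativeMonoid

    elt = Inverse.from enumeration
    q = p ℕ.^ e
    n = q ℕ.^ m

    instance
      p-nonTrivial : NonTrivial p
      p-nonTrivial = prime⇒nonTrivial pr
      p-nonZero : NonZero p
      p-nonZero = prime⇒nonZero pr
      n-nonZero : NonZero n
      n-nonZero = ℕ.m^n≢0 q m {{nonTrivial⇒nonZero q}}
      n-1-nonZero : NonZero (pred n)
      n-1-nonZero = ℕ.>-nonZero (ℕ.pred-mono-≤ (ℕ.≤-trans (nonTrivial⇒n>1 q)
        (≡.subst (_≤ n) (ℕ.^-identityʳ q) (ℕ.^-monoʳ-≤ q {{nonTrivial⇒nonZero q}} (ℕ.>-nonZero⁻¹ m)))))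

    n≡p^em : n ≡ p ℕ.^ (e ℕ.* m)
    n≡p^em = ℕ.^-*-assoc p e m

    p≈0 : p F×.× F.1# F.≈ F.0#
    p≈0 = characteristic p (e ℕ.* m) n≡p^em

    p∈I : Kernel (ι p)
    p∈I = kernel (F.trans (F.reflexive (ε-ι p)) p≈0)

    Point : Set c
    Point = Vec F.Carrier k ∧ F.Carrier

    points : List Point
    points = List.cartesianProduct (tuples elements k) elements

    -- inj₁ (a , t , _) stands for the term a xᵗ, inj₂ (a , s) for the term a y ^ (p ^ s).
    Gen : Set c
    Gen = (F.Carrier ∧ ∃[ t ] S q {k} t ≤ W) ⊎ (F.Carrier ∧ ℕ)

    coordinates : ∀ {k} → Vec F.Carrier k → Fin k → Expr
    coordinates x j = gen (lookup x j)

    value : Gen → Point → Expr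
    value (inj₁ (a , t , _)) (x , y) = gen a * ∏^ (coordinates x) (lookup t)
    value (inj₂ (a , s))     (x , y) = gen a * gen y ^ (p ℕ.^ s)

    -- The degree with respect to y ↦ λ y, where a term of `f` has degree 1 whatever its exponent
    -- vector. The powers of y in use are y ^ q and y, of degree 1 modulo `q - 1`.
    deg : Gen → ℕ
    deg (inj₁ _)       = 1
    deg (inj₂ (_ , s)) = p ℕ.^ s

  open Weights ring pr (pred q) value deg hiding (resp; plus)

  private
    xPart : Monomial → List (Vec ℕ k ∧ ℕ)
    xPart []                           = []
    xPart ((inj₁ (_ , t , _) , l) ∷ ls) = (t , l) ∷ xPart ls
    xPart ((inj₂ _ , l) ∷ ls)           = xPart ls

    yPart : Monomial → List ℕ
    yPart []                       = []
    yPart ((inj₁ _ , l) ∷ ls)       = yPart ls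
    yPart ((inj₂ (_ , s) , l) ∷ ls) = s ℕ.+ l ∷ yPart ls

    xPart-S≤W : ∀ ls → All (λ (t , _) → S q t ≤ W) (xPart ls)
    xPart-S≤W []                            = []
    xPart-S≤W ((inj₁ (_ , _ , S≤W) , l) ∷ ls) = S≤W ∷ xPart-S≤W ls
    xPart-S≤W ((inj₂ _ , l) ∷ ls)             = xPart-S≤W ls

    length-parts : ∀ ls → length (xPart ls) ℕ.+ length (yPart ls) ≡ length ls
    length-parts []                 = ≡.refl
    length-parts ((inj₁ _ , l) ∷ ls) = ≡.cong suc (length-parts ls)
    length-parts ((inj₂ _ , l) ∷ ls) = ≡.trans (ℕ.+-suc _ _) (≡.cong suc (length-parts ls))

    degree-parts : ∀ ls → degree ls ≡ powerSum p (List.map proj₂ (xPart ls)) ℕ.+ powerSum p (yPart ls)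
    degree-parts []                 = ≡.refl
    degree-parts ((inj₁ _ , l) ∷ ls) = ≡.trans
      (≡.cong₂ ℕ._+_ (ℕ.*-identityʳ (p ℕ.^ l)) (degree-parts ls))
      (≡.sym (ℕ.+-assoc (p ℕ.^ l) _ _))
    degree-parts ((inj₂ (_ , s) , l) ∷ ls) = ≡.trans
      (≡.cong₂ ℕ._+_ (≡.trans (ℕ.*-comm (p ℕ.^ l) (p ℕ.^ s)) (≡.sym (ℕ.^-distribˡ-+-* p s l))) (degree-parts ls))
      (NS.solve 3 (λ a b c → a NS.:+ (b NS.:+ c) NS.:= b NS.:+ (a NS.:+ c)) ≡.refl (p ℕ.^ (s ℕ.+ l)) (powerSum p (List.map proj₂ (xPart ls))) (powerSum p (yPart ls)))
      where module NS = +-*-Solver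

    coefficient : Monomial → Expr
    coefficient []                           = 1#
    coefficient ((inj₁ (a , _) , l) ∷ ls)     = gen a ^ (p ℕ.^ l) * coefficient ls
    coefficient ((inj₂ (a , _) , l) ∷ ls)     = gen a ^ (p ℕ.^ l) * coefficient ls

    xExponent : Monomial → Fin k → ℕ
    xExponent ls j = exponent p e m j (xPart ls)

    -- Separates the variables, so that the sum over all points becomes a product of one-variable
    -- power sums.
    ⟦⟧-factor : ∀ ls x y → ⟦ ls ⟧ (x , y) ≈
                coefficient ls * ∏^ (coordinates x) (xExponent ls) * gen y ^ powerSum p (yPart ls)
    ⟦⟧-factor [] x y = sym (trans (R.*-identityʳ _) (trans (R.*-identityˡ _) (Π.sum-replicate-zero k)))
    ⟦⟧-factor ((inj₁ (a , t , _) , l) ∷ ls) x y = begin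
      (gen a * ∏^ X (lookup t)) ^ P * ⟦ ls ⟧ (x , y)
        ≈⟨ R.*-cong (trans (^-distrib-* (gen a) (∏^ X (lookup t)) P) (R.*-congˡ {gen a ^ P} (∏^-^ X (lookup t) P))) (⟦⟧-factor ls x y) ⟩
      gen a ^ P * ∏^ X (λ j → P ℕ.* lookup t j) * (c₀ * ∏^ X u * Y)
        ≈⟨ solve 5 (λ a b c d e → a :* b :* (c :* d :* e) := a :* c :* (b :* d) :* e) refl (gen a ^ P) (∏^ X (λ j → P ℕ.* lookup t j)) c₀ (∏^ X u) Y ⟩
      gen a ^ P * c₀ * (∏^ X (λ j → P ℕ.* lookup t j) * ∏^ X u) * Y
        ≈⟨ R.*-congʳ (R.*-congˡ {gen a ^ P * c₀} (sym (∏^-+ X (λ j → P ℕ.* lookup t j) u))) ⟩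
      gen a ^ P * c₀ * ∏^ X (λ j → P ℕ.* lookup t j ℕ.+ u j) * Y ∎
      where
      P = p ℕ.^ l
      X = coordinates x
      c₀ = coefficient ls
      u = xExponent ls
      Y = gen y ^ powerSum p (yPart ls)
    ⟦⟧-factor ((inj₂ (a , s) , l) ∷ ls) x y = begin
      (gen a * gen y ^ (p ℕ.^ s)) ^ P * ⟦ ls ⟧ (x , y)
        ≈⟨ R.*-cong (trans (^-distrib-* (gen a) (gen y ^ (p ℕ.^ s)) P) (R.*-congˡ {gen a ^ P} (trans (^-assocʳ (gen y) (p ℕ.^ s) P) (^-congʳ (gen y) (≡.sym (ℕ.^-distribˡ-+-* p s l)))))) (⟦⟧-factor ls x y) ⟩
      gen a ^ P * gen y ^ (p ℕ.^ (s ℕ.+ l)) * (c₀ * V * gen y ^ h)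
        ≈⟨ solve 5 (λ a b c d e → a :* b :* (c :* d :* e) := a :* c :* d :* (b :* e)) refl (gen a ^ P) (gen y ^ (p ℕ.^ (s ℕ.+ l))) c₀ V (gen y ^ h) ⟩
      gen a ^ P * c₀ * V * (gen y ^ (p ℕ.^ (s ℕ.+ l)) * gen y ^ h)
        ≈⟨ R.*-congˡ {gen a ^ P * c₀ * V} (^-homo-* (gen y) (p ℕ.^ (s ℕ.+ l)) h) ⟨
      gen a ^ P * c₀ * V * gen y ^ (p ℕ.^ (s ℕ.+ l) ℕ.+ h) ∎
      where
      P = p ℕ.^ l
      c₀ = coefficient ls
      V = ∏^ (coordinates x) (xExponent ls)
      h = powerSum p (yPart ls)

    ∑L-elements : ∀ u → ∑L elements (λ a → gen a ^ u) ≈ fieldPowerSum u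
    ∑L-elements u = R.reflexive (≡.trans (∑L-map elt (List.allFin n) (λ a → gen a ^ u)) (∑L-tabulate (λ i → i) (λ i → gen (elt i) ^ u)))

    ∑L-tuples : ∀ {k} (u : Fin k → ℕ) → ∑L (tuples elements k) (λ x → ∏^ (coordinates x) u) ≈ Π.sum (fieldPowerSum ∘ u)
    ∑L-tuples {zero}  u = R.+-identityʳ 1#
    ∑L-tuples {suc k} u = trans
      (∑L-cartesianProductWith _∷_ elements (tuples elements k) {λ x → ∏^ (coordinates x) u} {λ a → gen a ^ u zero} {λ x → ∏^ (coordinates x) (u ∘ suc)} (λ _ _ → refl))
      (R.*-cong (∑L-elements (u zero)) (∑L-tuples (u ∘ suc)))

    ∑L-monomial : ∀ ls → ∑L points ⟦ ls ⟧ ≈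
                  coefficient ls * Π.sum (fieldPowerSum ∘ xExponent ls) * fieldPowerSum (powerSum p (yPart ls))
    ∑L-monomial ls = trans
      (∑L-cartesianProductWith _,_ (tuples elements k) elements {⟦ ls ⟧}
        {λ x → coefficient ls * ∏^ (coordinates x) (xExponent ls)} {λ y → gen y ^ powerSum p (yPart ls)} (⟦⟧-factor ls))
      (R.*-cong (trans (∑L-*ˡ (tuples elements k) (coefficient ls) (λ x → ∏^ (coordinates x) (xExponent ls)))
                       (R.*-congˡ {coefficient ls} (∑L-tuples (xExponent ls))))
                (∑L-elements (powerSum p (yPart ls))))

    fieldPowerSum-isZero : ∀ u → fieldPowerSum u ∈I^ e ℕ.* m ℕ.* isZero u
    fieldPowerSum-isZero zero    = ≡.subst (fieldPowerSum 0 ∈I^_) (≡.sym (ℕ.*-identityʳ (e ℕ.* m))) (fieldPowerSum-0 (e ℕ.* m) n≡p^em p∈I)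
    fieldPowerSum-isZero (suc u) = ≡.subst (fieldPowerSum (suc u) ∈I^_) (≡.sym (ℕ.*-zeroʳ (e ℕ.* m))) all

    I^-∏ : ∀ {k} (u : Fin k → ℕ) → Π.sum (fieldPowerSum ∘ u) ∈I^ e ℕ.* m ℕ.* ℕ-Sum.sum (isZero ∘ u)
    I^-∏ {zero}  u = ≡.subst (1# ∈I^_) (≡.sym (ℕ.*-zeroʳ (e ℕ.* m))) all
    I^-∏ {suc k} u = ≡.subst (Π.sum (fieldPowerSum ∘ u) ∈I^_) (≡.sym (ℕ.*-distribˡ-+ (e ℕ.* m) (isZero (u zero)) _))
      (I^-* (fieldPowerSum-isZero (u zero)) (I^-∏ (u ∘ suc)))

    I^-∏-factor : ∀ {k r} (f : Fin k → Expr) j → f j ∈I^ r → Π.sum f ∈I^ r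
    I^-∏-factor f zero    h = I^-*ʳ _ h
    I^-∏-factor f (suc j) h = I^-*ˡ (f zero) (I^-∏-factor (f ∘ suc) j h)

    K = e ℕ.* ⌈ m ℕ.* k / W ⌉

    -- One exponent not divisible by `q ^ m - 1` suffices, since its power sum lies in every power
    -- of `I`. If all are divisible, membership is collected from the coefficient and the absent
    -- variables, and `weight-estimate` compares the result with `K`.
    ∑L-term : ∀ {D} b v ls → p ℕ.^ v ∣ b → length ls ≤ e ℕ.* m ℕ.* pred p ℕ.+ v ℕ.* pred p →
              (∃[ a ] degree ls ≡ D ℕ.+ pred q ℕ.* a) → pred q ∣ D → ∑L points (λ z → ι b * ⟦ ls ⟧ z) ∈I^ K
    ∑L-term {D} b v ls (divides b′ b≡) len (a , deg≡) q-1∣D =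
      resp (trans (R.*-congˡ {ι b} (sym (∑L-monomial ls))) (sym (∑L-*ˡ points (ι b) ⟦ ls ⟧))) go
      where
      h = powerSum p (yPart ls)
      go : ι b * (coefficient ls * Π.sum (fieldPowerSum ∘ xExponent ls) * fieldPowerSum h) ∈I^ K
      go with Fin.all? (λ j → pred n ∣? xExponent ls j) | pred n ∣? h
      ... | no ¬∣u | _ = let j , n-1∤u = Fin.¬∀⟶∃¬ k _ (λ j → pred n ∣? xExponent ls j) ¬∣u in
        I^-*ˡ (ι b) (I^-*ʳ _ (I^-*ˡ (coefficient ls) (I^-∏-factor (fieldPowerSum ∘ xExponent ls) j (fieldPowerSum-∤ (xExponent ls j) n-1∤u K))))
      ... | yes _ | no ¬∣h = I^-*ˡ (ι b) (I^-*ˡ _ (fieldPowerSum-∤ h ¬∣h K))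
      ... | yes ∣u | yes ∣h = I^-≤ bound
        (I^-* ιb∈ (I^-* (I^-*ˡ (coefficient ls) (I^-∏ (xExponent ls))) (fieldPowerSum-isZero h)))
        where
        ιb∈ : ι b ∈I^ v
        ιb∈ = resp (trans (R.*-congˡ {ι b′} (sym (ι-^ p v))) (trans (sym (ι-* b′ (p ℕ.^ v))) (R.reflexive (≡.cong ι (≡.sym b≡)))))
          (I^-*ˡ (ι b′) (≡.subst (ι p ^ v ∈I^_) (ℕ.*-identityʳ v) (I^-^ v (Kernel⇒I^1 p∈I))))
        bound : K ≤ v ℕ.+ (e ℕ.* m ℕ.* ℕ-Sum.sum (isZero ∘ xExponent ls) ℕ.+ e ℕ.* m ℕ.* isZero h)
        bound = ≡.subst (K ≤_) (≡.cong (v ℕ.+_) (≡.trans (ℕ.*-distribˡ-+ (e ℕ.* m) (isZero h) _) (ℕ.+-comm (e ℕ.* m ℕ.* isZero h) _)))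
          (weight-estimate p e m (xPart ls) (yPart ls) (xPart-S≤W ls)
            (≡.subst₂ _≤_ (≡.sym (length-parts ls)) (≡.sym (ℕ.*-distribʳ-+ (pred p) (e ℕ.* m) v)) len)
            (≡.subst (pred q ∣_) (≡.trans (≡.sym deg≡) (degree-parts ls)) (∣m∣n⇒∣m+n q-1∣D (m∣m*n a)))
            ∣u ∣h)

    ∑L-weighted : ∀ {D f} → pred q ∣ D → Weighted D (e ℕ.* m ℕ.* pred p) f → ∑L points f ∈I^ K
    ∑L-weighted q-1∣D Weights.zeros = resp (sym (∑L-zero points)) (I^-0# K)
    ∑L-weighted q-1∣D (Weights.plus h h′) = resp (sym (∑L-+ points _ _)) (plus (∑L-weighted q-1∣D h) (∑L-weighted q-1∣D h′))
    ∑L-weighted q-1∣D (Weights.resp eq h) = resp (∑L-cong points eq) (∑L-weighted q-1∣D h)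
    ∑L-weighted q-1∣D (Weights.term b v ls ∣b len deg≡) = ∑L-term b v ls ∣b len deg≡ q-1∣D

  -- Reduced exponents and the lift of the polynomial.

  private
    -- `W` ranges over exponents below `q ^ m`, while `f` may contain larger ones. Positive
    -- exponents go to 1, ..., n - 1 and 0 is kept, since x ^ 0 and x ^ (n - 1) differ at 0. The
    -- values of monomials stay the same and exponents do not grow.
    reduce : ℕ → ℕ
    reduce zero    = 0
    reduce (suc u) = suc (u % pred n)

    ^-reduced : ∀ a u → a F^.^ reduce u F.≈ a F^.^ u
    ^-reduced a zero    = F.refl
    ^-reduced a (suc u) = F.sym (^-reduce a u)

    reduce-≤ : ∀ u → reduce u ≤ u
    reduce-≤ zero    = z≤n
    reduce-≤ (suc u) = s≤s (m%n≤m u (pred n))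

    reduce-< : ∀ u → reduce u < n
    reduce-< zero    = ℕ.>-nonZero⁻¹ n
    reduce-< (suc u) = ≡.subst (suc (u % pred n) <_) (ℕ.suc-pred n) (s≤s (m%n<n u (pred n)))

    sum-reduce-≤ : ∀ {k} (t : Vec ℕ k) → Vec.sum (Vec.map reduce t) ≤ Vec.sum t
    sum-reduce-≤ []      = z≤n
    sum-reduce-≤ (u ∷ t) = ℕ.+-mono-≤ (reduce-≤ u) (sum-reduce-≤ t)

    reduce∈tuples : ∀ {k} (t : Vec ℕ k) → Vec.map reduce t ∈ tuples (List.upTo n) k
    reduce∈tuples []      = here ≡.refl
    reduce∈tuples (u ∷ t) = ∈-cartesianProductWith⁺ _∷_ (∈-upTo⁺ (reduce-< u)) (reduce∈tuples t)

    S-reduce-≤-W : ∀ d (t : Vec ℕ k) → Vec.sum t ≤ d → S q (Vec.map reduce t) ≤ Defs.W q m k d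
    S-reduce-≤-W d t ∑t≤d = All.lookup (xs≤max 0 _) (∈-map⁺ (S q)
      (∈-filter⁺ (λ t → Vec.sum t ℕ.≤? d) (reduce∈tuples t) (ℕ.≤-trans (sum-reduce-≤ t) ∑t≤d)))

  module _ {r z} {Z : Set z} {P : Pred Z r} (P? : Decidable₁ P) {K} (Y : Z → Expr)
           (Y∈ : ∀ z → P z → Y z ∈I^ K) (Y≈1 : ∀ z → ¬ P z → ∃[ r ] r ∈I^ K ∧ Y z ≈ r + 1#) where

    -- Modulo `I ^ K` the sum of `Y` counts the points outside `P`; this is written without
    -- subtraction.
    count : ∀ zs → ∃[ r ] r ∈I^ K ∧
      ι (length (List.filter P? zs)) + ∑L zs (λ z → Y z) ≈ ∑L zs (λ _ → 1#) + r
    count []       = 0# , I^-0# K , refl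
    count (z ∷ zs) with P? z | count zs
    ... | yes Pz | r , r∈ , eq = Y z + r , plus (Y∈ z Pz) r∈ , (begin
      1# + l + (x + s)     ≈⟨ solve 4 (λ a b c d → a :+ b :+ (c :+ d) := a :+ c :+ (b :+ d)) refl 1# l x s ⟩
      1# + x + (l + s)     ≈⟨ R.+-congˡ eq ⟩
      1# + x + (o + r)     ≈⟨ solve 4 (λ a b c d → a :+ b :+ (c :+ d) := a :+ c :+ (b :+ d)) refl 1# x o r ⟩
      1# + o + (x + r)     ∎)
      where
      l = ι (length (List.filter P? zs))
      x = Y z
      s = ∑L zs (λ z → Y z)
      o = ∑L zs (λ _ → 1#)
    ... | no ¬Pz | r , r∈ , eq = let r′ , r′∈ , eq′ = Y≈1 z ¬Pz in r + r′ , plus r∈ r′∈ , (begin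
      l + (Y z + s)    ≈⟨ R.+-congˡ (R.+-congʳ eq′) ⟩
      l + (r′ + 1# + s)    ≈⟨ solve 4 (λ a b c d → a :+ (b :+ c :+ d) := (a :+ d) :+ (b :+ c)) refl l r′ 1# s ⟩
      l + s + (r′ + 1#)    ≈⟨ R.+-congʳ eq ⟩
      o + r + (r′ + 1#)    ≈⟨ solve 4 (λ a b c d → a :+ b :+ (c :+ d) := d :+ a :+ (b :+ c)) refl o r r′ 1# ⟩
      1# + o + (r + r′)    ∎)
      where
      l = ι (length (List.filter P? zs))
      s = ∑L zs (λ z → Y z)
      o = ∑L zs (λ _ → 1#)

  module _ (f : Polynomial F k) (d : ℕ) (f-degree : HasDegree f d) (W≡ : Defs.W q m k d ≡ W) where
    open Polynomial f

    private
      S≤W : ∀ t → ¬ coeff t F.≈ F.0# → S q (Vec.map reduce t) ≤ W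
      S≤W t c≉0 = ≡.subst (S q (Vec.map reduce t) ≤_) W≡
        (S-reduce-≤-W d t (ℕ.≮⇒≥ λ d<∑t → c≉0 (proj₂ f-degree t d<∑t)))

      -- Entries with zero coefficient are dropped because the degree bounds only exponents with
      -- nonzero coefficient, and a generator must carry the proof of its digit sum bound.
      terms : List (Vec ℕ k) → List Gen
      terms []       = []
      terms (t ∷ ts) with coeff t ≈? F.0#
      ... | yes _   = terms ts
      ... | no  c≉0 = inj₁ (coeff t , Vec.map reduce t , S≤W t c≉0) ∷ terms ts

      -- f(x) - y ^ q + y with every coefficient and variable replaced by its generator in ℤ[F].
      X : Point → Expr
      X z = ∑L (inj₂ (F.- F.1# , e) ∷ inj₂ (F.1# , 0) ∷ terms support) (λ g → value g z)

      X-weighted : Weighted 1 1 X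
      X-weighted = Weights.plus (generator (inj₂ (F.- F.1# , e)) 1 q≡) (Weights.plus (generator (inj₂ (F.1# , 0)) 0 1≡) (terms-weighted support))
        where
        q≡ : q ≡ 1 ℕ.+ pred q ℕ.* 1
        q≡ = ≡.sym (≡.trans (≡.cong suc (ℕ.*-identityʳ (pred q))) (ℕ.suc-pred q {{nonTrivial⇒nonZero q}}))
        1≡ : 1 ≡ 1 ℕ.+ pred q ℕ.* 0
        1≡ = ≡.cong suc (≡.sym (ℕ.*-zeroʳ (pred q)))
        terms-weighted : ∀ ts → Weighted 1 1 (λ z → ∑L (terms ts) (λ g → value g z))
        terms-weighted []       = Weights.zeros
        terms-weighted (t ∷ ts) with coeff t ≈? F.0#
        ... | yes _ = terms-weighted ts
        ... | no c≉0 = Weights.plus (generator (inj₁ (coeff t , Vec.map reduce t , S≤W t c≉0)) 0 1≡) (terms-weighted ts)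

      ε-gen-^ : ∀ a u → ε (gen a ^ u) F.≈ a F^.^ u
      ε-gen-^ a u = ε-cong (sym (gen-^ a u))

      ε-∏^ : ∀ {k} (x : Vec F.Carrier k) t → ε (∏^ (coordinates x) (lookup (Vec.map reduce t))) F.≈ monomial {F = F} t x
      ε-∏^ []      []      = F.refl
      ε-∏^ (a ∷ x) (u ∷ t) = F.*-cong (F.trans (ε-gen-^ a (reduce u)) (^-reduced a u)) (ε-∏^ x t)

      ε-terms : ∀ ts x y → ε (∑L (terms ts) (λ g → value g (x , y))) F.≈
                List.foldr F._+_ F.0# (List.map (λ t → coeff t F.* monomial {F = F} t x) ts)
      ε-terms []       x y = F.refl
      ε-terms (t ∷ ts) x y with coeff t ≈? F.0#
      ... | yes c≈0 = F.trans (ε-terms ts x y)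
        (F.sym (F.trans (F.+-congʳ (F.trans (F.*-congʳ c≈0) (F.zeroˡ _))) (F.+-identityˡ _)))
      ... | no  _   = F.+-cong (F.*-congˡ (ε-∏^ x t)) (ε-terms ts x y)

      module Z = Relation.Binary.Reasoning.Setoid F.setoid
      open Algebra.Properties.Ring F.ring using (-‿anti-homo-+; -1*x≈-x)
      open Algebra.Properties.Group F.+-group using (⁻¹-involutive; x∙y⁻¹≈ε⇒x≈y)

      ε-X : ∀ x y → ε (X (x , y)) F.≈ eval f x F.- (y F^.^ q F.- y)
      ε-X x y = Z.begin
        F.- F.1# F.* ε (gen y ^ q) F.+ (F.1# F.* ε (gen y ^ 1) F.+ ε (∑L (terms support) (λ g → value g (x , y))))
          Z.≈⟨ F.+-cong (F.trans (-1*x≈-x _) (F.-‿cong (ε-gen-^ y q)))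
                        (F.+-cong (F.trans (F.*-identityˡ _) (F.*-identityʳ y)) (ε-terms support x y)) ⟩
        F.- (y F^.^ q) F.+ (y F.+ eval f x)
          Z.≈⟨ F.+-assoc _ _ _ ⟨
        F.- (y F^.^ q) F.+ y F.+ eval f x
          Z.≈⟨ F.+-comm _ _ ⟩
        eval f x F.+ (F.- (y F^.^ q) F.+ y)
          Z.≈⟨ F.+-congˡ (F.trans (F.+-comm _ _) (F.trans (F.+-congʳ (F.sym (⁻¹-involutive y))) (F.sym (-‿anti-homo-+ (y F^.^ q) (F.- y))))) ⟩
        eval f x F.- (y F^.^ q F.- y) Z.∎

      Solution : Point → Set ℓ
      Solution (x , y) = eval f x F.≈ (y F^.^ q) F.- y

      solution? : Decidable₁ Solution
      solution? (x , y) = eval f x ≈? ((y F^.^ q) F.- y)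

      M : ℕ
      M = p ℕ.^ K ℕ.* pred n

      -- Applied with `b` equal to 0 and 1. The hypothesis is a congruence modulo `I`, and each of
      -- the `K` p-th powers improves it by one power of `I`.
      ^M-congruence : ∀ {b} {x : Expr} → ε (x ^ pred n) F.≈ ε b → ∃[ r ] r ∈I^ K ∧ x ^ M ≈ r + b ^ (p ℕ.^ K)
      ^M-congruence {b} {x} eq =
        let r , r∈ , eq′ = ^p^-congruence pr p∈I K kernel-difference difference
        in r , I^-pred r∈ , trans (trans (^-congʳ x (ℕ.*-comm (p ℕ.^ K) (pred n))) (sym (^-assocʳ x (pred n) (p ℕ.^ K)))) eq′
        where
        kernel-difference : Kernel (x ^ pred n + - b)
        kernel-difference = kernel (F.trans (F.+-congʳ eq) (F.-‿inverseʳ (ε b)))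
        difference : x ^ pred n ≈ x ^ pred n + - b + b
        difference = sym (trans (R.+-assoc _ _ _) (trans (R.+-congˡ (R.-‿inverseˡ b)) (R.+-identityʳ _)))

      ε-^ : ∀ x u → ε (x ^ u) F.≈ ε x F^.^ u
      ε-^ x zero    = F.refl
      ε-^ x (suc u) = F.*-congˡ (ε-^ x u)

      X^M-solution : ∀ z → Solution z → X z ^ M ∈I^ K
      X^M-solution z@(x , y) sol =
        let r , r∈ , eq = ^M-congruence {0#} {X z} εX^≈0
        in resp (trans (sym (trans (R.+-congˡ (0#^ (p ℕ.^ K) {{ℕ.m^n≢0 p K}})) (R.+-identityʳ r))) (sym eq)) r∈
        where
        εX≈0 : ε (X z) F.≈ F.0#
        εX≈0 = F.trans (ε-X x y) (F.trans (F.+-congʳ sol) (F.-‿inverseʳ _))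
        εX^≈0 : ε (X z ^ pred n) F.≈ F.0#
        εX^≈0 = F.trans (ε-^ (X z) (pred n)) (F.trans (F^.^-congˡ (pred n) εX≈0) (Frobenius.0#^ fieldRing (pred n)))

      X^M-nonsolution : ∀ z → ¬ Solution z → ∃[ r ] r ∈I^ K ∧ X z ^ M ≈ r + 1#
      X^M-nonsolution z@(x , y) ¬sol =
        let r , r∈ , eq = ^M-congruence {1#} {X z} εX^≈1
        in r , r∈ , trans eq (R.+-congˡ (1#^ (p ℕ.^ K)))
        where
        εX≉0 : ¬ ε (X z) F.≈ F.0#
        εX≉0 εX≈0 = ¬sol (x∙y⁻¹≈ε⇒x≈y _ _ (F.trans (F.sym (ε-X x y)) εX≈0))
        εX^≈1 : ε (X z ^ pred n) F.≈ F.1#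
        εX^≈1 = F.trans (ε-^ (X z) (pred n)) (*-cancelˡ-nonzero _ _ εX≉0
          (F.trans (F.reflexive (≡.cong (ε (X z) F^.^_) (ℕ.suc-pred n))) (F.trans (fermat (ε (X z))) (F.sym (F.*-identityʳ _)))))

      -- The constant 1 is the empty monomial, of degree 0, so the number of points is covered by
      -- the estimate for terms.
      ∑1∈ : ∑L points (λ _ → 1#) ∈I^ K
      ∑1∈ = resp (∑L-cong points (λ _ → trans (R.*-identityʳ (ι 1)) (R.+-identityʳ 1#)))
        (∑L-term {0} 1 0 [] (1∣ 1) z≤n (0 , ≡.sym (ℕ.*-zeroʳ (pred q))) (pred q ∣0))

      ∑X^M∈ : ∑L points (λ z → X z ^ M) ∈I^ K
      ∑X^M∈ = ∑L-weighted q-1∣M (weighted-≡ M≡ ≡.refl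
          (Weights.resp (λ z → ^-congʳ (X z) M≡) (weighted-^pred K (e ℕ.* m) X-weighted)))
        where
        M≡ : p ℕ.^ K ℕ.* pred (p ℕ.^ (e ℕ.* m)) ≡ M
        M≡ = ≡.cong (λ n → p ℕ.^ K ℕ.* pred n) (≡.sym n≡p^em)
        q-1∣M : pred q ∣ M
        q-1∣M = ∣n⇒∣m*n (p ℕ.^ K) (≡.subst (pred q ∣_) (≡.sym (pred-^ q m {{nonTrivial⇒nonZero q}})) (m∣m*n _))

      ιN∈ : ι (N f q) ∈I^ K
      ιN∈ = let r , r∈ , eq = count solution? (λ z → X z ^ M) X^M-solution X^M-nonsolution points in
        resp (trans (R.+-congʳ (sym eq)) (trans (R.+-assoc _ _ _) (trans (R.+-congˡ (R.-‿inverseʳ _)) (R.+-identityʳ _))))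
          (plus (plus ∑1∈ r∈) (I^-neg ∑X^M∈))

    ^∣N : p ℕ.^ (e ℕ.* ⌈ m ℕ.* k / W ⌉) ∣ N f q
    ^∣N = I^-ι⇒∣ pr p≈0 K (N f q) ιN∈

-- From divisibility to the valuation.

m<p^m : ∀ p .{{_ : NonTrivial p}} m → m < p ℕ.^ m
m<p^m p zero    = s≤s z≤n
m<p^m p (suc m) = ℕ.≤-<-trans (m<p^m p m) (ℕ.^-monoʳ-< p (nonTrivial⇒n>1 p) (ℕ.n<1+n m))

-- `K` is among the exponents that `ν` searches, as K < p ^ K ≤ n; for `n` equal to 0 the valuation
-- is infinite.
p^∣⇒≤ν : ∀ p .{{_ : NonTrivial p}} K n → p ℕ.^ K ∣ n → [ K ] ≤⁺ ν p n
p^∣⇒≤ν p K zero      _     = [ K ] ≤⊤⁺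
p^∣⇒≤ν p K n@(suc _) p^K∣n = [ v≤max⁺ 0 _ (inj₂ (lose
  (∈-filter⁺ (λ r → p ℕ.^ r ∣? n) (∈-upTo⁺ (ℕ.<-≤-trans (m<p^m p K) (∣⇒≤ p^K∣n))) p^K∣n) ℕ.≤-refl)) ]

open import Data.Nat.Base using (_*_; _^_)

theorem5p6 : ∀ {c ℓ} (p e q m k d : ℕ) .{{_ : NonTrivial q}} .{{_ : NonZero m}} .{{_ : NonZero k}} .{{_ : NonZero d}} →
    Prime p → q ≡ p ^ e →
    (F : FiniteField c ℓ (q ^ m)) (f : Polynomial F k) → HasDegree f d →
    [ e * ⌈_/_⌉ (m * k) (W q m k d) {{W-nonZero q m k d}} ] ≤⁺ ν p (N f q)
-- Here `q` would be 1, against `NonTrivial q`.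
theorem5p6 p zero      q m k d pr ≡.refl F f f-degree = contradiction (nonTrivial⇒n>1 1) λ { (s≤s ()) }
theorem5p6 p e@(suc _) q m k d pr ≡.refl F f f-degree = p^∣⇒≤ν p _ (N f q) (^∣N p e m k (W q m k d) pr F f d f-degree ≡.refl)
  where
  instance
    p-nonTrivial : NonTrivial p
    p-nonTrivial = prime⇒nonTrivial pr
    W≢0 : NonZero (W q m k d)
    W≢0 = W-nonZero q m k d
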